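{- Let $\epsilon,\epsilon'\in(0,0.5)$ be constants, $\ell\in\mathbb{N}$ and $k\le\ell-4$. Suppose $\mathtt{nmE}:[2^\ell-1]\times[2^\ell-1]\to\{0,1\}$ is a non-malleable two-source $(k,\epsilon)$-extractor such that for every $x$, $|\{y:\mathtt{nmE}(x,y)=1\}|>\epsilon'\cdot2^\ell$, and suppose $B:[2^\ell-1]\times[2^{\ell+2}-1]\to\{0,1\}$ is quasi-orthogonal with error $0.1\epsilon'$. Let $G=(V_0\cup V_1\cup V_2,E)$ be the $(6\cdot2^\ell-3)$-vertex graph with $V_\sigma=\{\langle\sigma,i\rangle:i\in[2^{\ell_\sigma}-1]\}$, $\ell_0=\ell_1=\ell$, $\ell_2=\ell+2$, and $E=\{\{\langle1,i\rangle,\langle0,j\rangle\}:\mathtt{nmE}(i,j)=1\}\cup\{\{\langle\sigma,i\rangle,\langle2,j\rangle\}:B(i,j)=1,\sigma\in\{0,1\}\}\cup\binom{V_1}{2}\cup\binom{V_2}{2}$. Let $V=V_0\cup V_1\cup V_2$. Then $G$ is $\Omega(|V|)$-robustly self-ordered (with the constant depending only on $\epsilon,\epsilon'$). Furthermore, every vertex of $G$ has degree at least $0.3|V|$ and at most $0.9|V|$.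
   Context: Here the sources are over $[N]$ with $N=2^\ell-1$: a random variable over $[N]$ is a $k$-source if each value has probability at most $2^{ -k}$. $\mathtt{nmE}:[N]\times[N]\to\{0,1\}$ is a non-malleable two-source $(k,\epsilon)$-extractor if for every two independent such sources $X,Y$ and every $f,g:[N]\to[N]$ without fixed points, $\frac12\sum_{\alpha,\beta\in\{0,1\}}\big|\Pr[(\mathtt{nmE}(X,Y),\mathtt{nmE}(f(X),g(Y)))=(\alpha,\beta)]-\frac12\Pr[\mathtt{nmE}(f(X),g(Y))=\beta]\big|\le\epsilon$. A bipartite adjacency predicate $B:X\times Y\to\{0,1\}$ is quasi-orthogonal with error $\delta$ if (1) for every $x\in X$, $|\{y:B(x,y)=1\}|=(0.5\pm\delta)|Y|$, and for every $y\in Y$, $|\{x:B(x,y)=1\}|=(0.5\pm\delta)|X|$; and (2) for every $x\ne x'\in X$, $|\{y:B(x,y)\ne B(x',y)\}|=(0.5\pm\delta)|Y|$, and similarly for every $y\ne y'\in Y$. A graph $G=(V,E)$ is $\rho$-robustly self-ordered if for every permutation $\pi$ of $V$, $|E\triangle\{\{\pi(u),\pi(v)\}:\{u,v\}\in E\}|\ge\rho|\{v:\pi(v)\ne v\}|$.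
   Formalization: The constants ε and ε′ are taken to be rational numbers in (0, 0.5) rather than real numbers. -}

module Defs where

open import Data.Bool using (Bool; true; false; not; _∧_; if_then_else_)
open import Data.Nat as ℕ using (ℕ; zero; suc; _^_; _∸_)
open import Data.Fin as Fin using (Fin)
import Data.Fin.Properties as FinP
open import Data.Sum using (_⊎_; inj₁; inj₂)
import Data.Sum.Properties as SumP
open import Data.Integer using (+_)
open import Data.Rational using (ℚ; 0ℚ; 1ℚ; ½; _+_; _*_; _-_; ∣_∣; _≤_; _<_; _/_)
open import Data.Product using (_×_)
open import Relation.Binary.PropositionalEquality using (_≡_; _≢_)
open import Relation.Nullary using (does)
open import Function.Bundles using (_↔_; Inverse)

ℕ→ℚ : ℕ → ℚ
ℕ→ℚ n = (+ n) / 1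

sumℚ : (n : ℕ) → (Fin n → ℚ) → ℚ
sumℚ zero    f = 0ℚ
sumℚ (suc n) f = f Fin.zero + sumℚ n (λ i → f (Fin.suc i))

sumℕ : (n : ℕ) → (Fin n → ℕ) → ℕ
sumℕ zero    f = 0
sumℕ (suc n) f = f Fin.zero ℕ.+ sumℕ n (λ i → f (Fin.suc i))

ind : Bool → ℕ
ind true  = 1
ind false = 0

indℚ : Bool → ℚ
indℚ b = ℕ→ℚ (ind b)

countFin : (n : ℕ) → (Fin n → Bool) → ℕ
countFin n P = sumℕ n (λ i → ind (P i))

_==_ : Bool → Bool → Bool
true  == b = b
false == b = not b

within : ℚ → ℚ → ℕ → ℕ → Set
within c δ m x = ∣ ℕ→ℚ x - c * ℕ→ℚ m ∣ ≤ δ * ℕ→ℚ m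

record Source (N k : ℕ) : Set where
  field
    pr       : Fin N → ℚ
    nonneg   : ∀ i → 0ℚ ≤ pr i
    total    : sumℚ N pr ≡ 1ℚ
    minEntr  : ∀ i → pr i * ℕ→ℚ (2 ^ k) ≤ 1ℚ
open Source public

NoFixedPoint : {N : ℕ} → (Fin N → Fin N) → Set
NoFixedPoint f = ∀ x → f x ≢ x

jointPr : {N k : ℕ} → (Fin N → Fin N → Bool) → Source N k → Source N k →
          (Fin N → Fin N) → (Fin N → Fin N) → Bool → Bool → ℚ
jointPr {N} E X Y f g α β =
  sumℚ N (λ x → sumℚ N (λ y →
    pr X x * pr Y y * indℚ ((E x y == α) ∧ (E (f x) (g y) == β))))

tamperedPr : {N k : ℕ} → (Fin N → Fin N → Bool) → Source N k → Source N k →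
             (Fin N → Fin N) → (Fin N → Fin N) → Bool → ℚ
tamperedPr {N} E X Y f g β =
  sumℚ N (λ x → sumℚ N (λ y → pr X x * pr Y y * indℚ (E (f x) (g y) == β)))

sum₂ : (Bool → ℚ) → ℚ
sum₂ h = h false + h true

NonMalleableExtractor : (N k : ℕ) → ℚ → (Fin N → Fin N → Bool) → Set
NonMalleableExtractor N k ε E =
  (X Y : Source N k) (f g : Fin N → Fin N) → NoFixedPoint f → NoFixedPoint g →
  ½ * sum₂ (λ α → sum₂ (λ β →
      ∣ jointPr E X Y f g α β - ½ * tamperedPr E X Y f g β ∣)) ≤ ε

QuasiOrthogonal : (n m : ℕ) → ℚ → (Fin n → Fin m → Bool) → Set
QuasiOrthogonal n m δ B =
  (∀ x → within ½ δ m (countFin m (λ y → B x y))) ×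
  (∀ y → within ½ δ n (countFin n (λ x → B x y))) ×
  (∀ x x′ → x ≢ x′ → within ½ δ m (countFin m (λ y → not (B x y == B x′ y)))) ×
  (∀ y y′ → y ≢ y′ → within ½ δ n (countFin n (λ x → not (B x y == B x y′))))

-- Graphs on a finite vertex type, given by a symmetric loopless
-- adjacency predicate, together with a counting operator over vertices

record FinGraph : Set₁ where
  field
    V       : Set
    _≟V_    : (u v : V) → Bool
    sumV    : (V → ℕ) → ℕ
    size    : ℕ
    Adj     : V → V → Bool

module _ (G : FinGraph) where
  open FinGraph G

  countV : (V → Bool) → ℕ
  countV P = sumV (λ v → ind (P v))

  degree : V → ℕ
  degree v = countV (Adj v)

  moved : (V ↔ V) → ℕ
  moved π = countV (λ v → not (Inverse.to π v ≟V v))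

  -- number of ordered pairs (a,b) such that {a,b} ∈ E △ π(E), where
  -- {a,b} ∈ π(E) iff {π⁻¹ a, π⁻¹ b} ∈ E.  Since Adj is loopless and
  -- symmetric this is twice |E △ π(E)|.
  orderedSymDiff : (V ↔ V) → ℕ
  orderedSymDiff π = sumV (λ a → countV (λ b →
    not (Adj a b == Adj (Inverse.from π a) (Inverse.from π b))))

  RobustlySelfOrdered : ℚ → Set
  RobustlySelfOrdered ρ = (π : V ↔ V) →
    ρ * ℕ→ℚ (moved π) ≤ ½ * ℕ→ℚ (orderedSymDiff π)

-- The graph G of Theorem 8.7.
-- Vertices: V₀ = inj₁ i, V₁ = inj₂ (inj₁ i) (i ∈ [2^ℓ−1]),
--           V₂ = inj₂ (inj₂ j) (j ∈ [2^{ℓ+2}−1]).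

Vtx : ℕ → Set
Vtx ℓ = Fin (2 ^ ℓ ∸ 1) ⊎ (Fin (2 ^ ℓ ∸ 1) ⊎ Fin (2 ^ (ℓ ℕ.+ 2) ∸ 1))

finEq : {n : ℕ} → Fin n → Fin n → Bool
finEq i j = does (i FinP.≟ j)

vtxEq : (ℓ : ℕ) → Vtx ℓ → Vtx ℓ → Bool
vtxEq ℓ (inj₁ i)        (inj₁ j)        = finEq i j
vtxEq ℓ (inj₂ (inj₁ i)) (inj₂ (inj₁ j)) = finEq i j
vtxEq ℓ (inj₂ (inj₂ i)) (inj₂ (inj₂ j)) = finEq i j
vtxEq ℓ _ _ = false

sumVtx : (ℓ : ℕ) → (Vtx ℓ → ℕ) → ℕ
sumVtx ℓ h = sumℕ (2 ^ ℓ ∸ 1) (λ i → h (inj₁ i))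
       ℕ.+ sumℕ (2 ^ ℓ ∸ 1) (λ i → h (inj₂ (inj₁ i)))
       ℕ.+ sumℕ (2 ^ (ℓ ℕ.+ 2) ∸ 1) (λ j → h (inj₂ (inj₂ j)))

adjG : (ℓ : ℕ) → (Fin (2 ^ ℓ ∸ 1) → Fin (2 ^ ℓ ∸ 1) → Bool) →
       (Fin (2 ^ ℓ ∸ 1) → Fin (2 ^ (ℓ ℕ.+ 2) ∸ 1) → Bool) →
       Vtx ℓ → Vtx ℓ → Bool
adjG ℓ E B (inj₁ j)        (inj₁ j′)       = false
adjG ℓ E B (inj₁ j)        (inj₂ (inj₁ i)) = E i j
adjG ℓ E B (inj₂ (inj₁ i)) (inj₁ j)        = E i j
adjG ℓ E B (inj₂ (inj₁ i)) (inj₂ (inj₁ i′)) = not (finEq i i′)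
adjG ℓ E B (inj₁ i)        (inj₂ (inj₂ j)) = B i j
adjG ℓ E B (inj₂ (inj₂ j)) (inj₁ i)        = B i j
adjG ℓ E B (inj₂ (inj₁ i)) (inj₂ (inj₂ j)) = B i j
adjG ℓ E B (inj₂ (inj₂ j)) (inj₂ (inj₁ i)) = B i j
adjG ℓ E B (inj₂ (inj₂ j)) (inj₂ (inj₂ j′)) = not (finEq j j′)

graphG : (ℓ : ℕ) → (Fin (2 ^ ℓ ∸ 1) → Fin (2 ^ ℓ ∸ 1) → Bool) →
         (Fin (2 ^ ℓ ∸ 1) → Fin (2 ^ (ℓ ℕ.+ 2) ∸ 1) → Bool) → FinGraph
graphG ℓ E B = record
  { V = Vtx ℓ
  ; _≟V_ = vtxEq ℓ
  ; sumV = sumVtx ℓ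
  ; size = 6 ℕ.* 2 ^ ℓ ∸ 3
  ; Adj = adjG ℓ E B
  }

{-# OPTIONS --safe #-}

-- Let p = π⁻¹ and let D be the sum over all v of the defect #{u : Adj v u ≠ Adj (p v) (p u)}.
-- Write n = |V₀| = |V₁|, so |V₂| = 4n + 3.
--
-- (1) The degrees in V₀, V₁, V₂ lie in intervals that are Ω(n) apart, so every vertex changing
--     its part has defect Ω(n).  The additive slack is absorbed because n is odd: a count within
--     δ n of n / 2 forces δ n ≥ 1 / 2.
-- (2) If at most 2/5 of V₂ moves, each vertex of V₀ and V₁ moved within its part has defect Ω(n),
--     since its row of B differs from that of its image in at least 9/20 of V₂.  Likewise for V₂
--     with columns of B, if at most 2/5 of V₀, or at most 2/5 of V₁, moves.
-- (3) In the remaining case many vertices of both V₀ and V₁ move within their parts (or many change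
--     parts, and (1) suffices).  Uniform distributions on them are k-sources tampered by π, so the
--     extractor gives Ω(n²) pairs of V₁ × V₀ whose adjacency changes.
module Submission where

open import Defs

-- Counting arguments over the natural numbers.

module Combinatorics where

  open import Data.Bool using (Bool; true; false; not; _∧_)
  open import Data.Fin using (Fin; zero; suc; splitAt; fromℕ<; punchIn)
  import Data.Fin.Properties as FinP
  open import Data.Nat as ℕ using (ℕ; zero; suc; _^_; _∸_; _≤_; _<_; z≤n; s≤s; _+_; _*_; NonZero)
  open import Data.Nat.Properties
  open import Data.Nat.Tactic.RingSolver using (solve-∀)
  open import Data.Product using (_×_; Σ; _,_; proj₁; proj₂)
  open import Data.Sum as Sum using (_⊎_; inj₁; inj₂)
  open import Data.Sum.Function.Propositional using (_⊎-↔_)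
  open import Algebra.Properties.Semiring.Sum +-*-semiring using (sum; sum-permute; *-distribˡ-sum; ∑-distrib-+)
  open import Function using (_∘_)
  open import Function.Bundles using (_↔_; Inverse)
  open import Function.Construct.Composition using (_↔-∘_)
  open import Function.Construct.Identity using (↔-id)
  open import Function.Construct.Symmetry using (↔-sym)
  open import Relation.Binary.PropositionalEquality
    using (_≡_; _≢_; ≢-sym; refl; sym; trans; cong; cong₂; subst; subst₂; module ≡-Reasoning)
  open import Relation.Nullary using (yes; no; contradiction)

  -- A certificate for linear arithmetic: `x ≤ y` is a weighted sum of known inequalities, `s` is
  -- the slack left over, and the equation is a ring identity for the solver. Keeping everything
  -- additive avoids truncated subtraction.
  ≤-by : ∀ {x y a b} s → x ≤ y → a + (y + s) ≡ b + x → a ≤ b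
  ≤-by {x} {y} {a} {b} s x≤y eq = +-cancelʳ-≤ y a b (begin
    a + y        ≤⟨ +-monoʳ-≤ a (m≤m+n y s) ⟩
    a + (y + s)  ≡⟨ eq ⟩
    b + x        ≤⟨ +-monoʳ-≤ b x≤y ⟩
    b + y        ∎)
    where open ≤-Reasoning

  ≤-slack : ∀ a s {b} → a + s ≡ b → a ≤ b
  ≤-slack a s refl = m≤m+n a s

  -- Case analysis on which parts are heavily moved.

  -- D is the total defect and C the number of vertices changing part; of the vertices of Vᵢ,
  -- mᵢ are moved and sᵢ are moved within Vᵢ.
  module Counting {n q r D C s₀ s₁ s₂ m₀ m₁ m₂ : ℕ}
    (m₀≤ : m₀ ≤ s₀ + C) (m₁≤ : m₁ ≤ s₁ + C) (m₂≤ : m₂ ≤ s₂ + C)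
    (total≤ : s₀ + s₁ + s₂ + C ≤ 7 * n)
    (crossing : C * n ≤ q * D)
    (rows : 5 * m₂ ≤ 2 * (4 * n + 3) → (s₀ + s₁) * n ≤ 20 * D)
    (columns₀ : 5 * m₀ ≤ 2 * n → s₂ * n ≤ 20 * D)
    (columns₁ : 5 * m₁ ≤ 2 * n → s₂ * n ≤ 20 * D)
    (blocks : n + 1 ≤ 16 * s₀ → n + 1 ≤ 16 * s₁ → s₀ * s₁ ≤ r * D)
    where

    open ≤-Reasoning

    private
      -- One constant for all cases: 256 is the 16 · 16 of `two-blocks`, and it also dominates the
      -- `80 * q` of `many-crossings` and the `50 + 3 * q` of `one-part`.
      K = 256 * (q + r + 1)

      -- Every case but one ends here: once `D` is of order n², the trivial bound of 7 n on the
      -- number of moved vertices suffices.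
      quadratic : n * n ≤ K * D → (s₀ + s₁ + s₂ + C) * n ≤ 7 * K * D
      quadratic n²≤ = begin
        (s₀ + s₁ + s₂ + C) * n  ≤⟨ *-monoˡ-≤ n total≤ ⟩
        7 * n * n               ≡⟨ *-assoc 7 n n ⟩
        7 * (n * n)             ≤⟨ *-monoʳ-≤ 7 n²≤ ⟩
        7 * (K * D)             ≡⟨ *-assoc 7 K D ⟨
        7 * K * D               ∎

      -- Each of the 2 n / 5 or more moved vertices either stays in its part or crosses, and both
      -- kinds are charged to `D` at a rate of order n per vertex.
      one-part : ∀ {s m} → m ≤ s + C → 2 * n ≤ 5 * m → s * n ≤ 20 * D → n * n ≤ K * D
      one-part {s} {m} m≤ n≤m sn≤D = begin
        n * n             ≤⟨ *-cancelˡ-≤ 2 double ⟩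
        (50 + 3 * q) * D  ≤⟨ *-monoˡ-≤ D {50 + 3 * q} {K}
                               (≤-slack (50 + 3 * q) (256 * r + 253 * q + 206) (constants q r)) ⟩
        K * D             ∎
        where
        constants : ∀ q r → 50 + 3 * q + (256 * r + 253 * q + 206) ≡ 256 * (q + r + 1)
        constants = solve-∀
        expand : ∀ s C n → 5 * (s + C) * n ≡ 5 * (s * n + C * n)
        expand = solve-∀
        collect : ∀ D q → 5 * (20 * D + q * D) + q * D ≡ 2 * ((50 + 3 * q) * D)
        collect = solve-∀
        double : 2 * (n * n) ≤ 2 * ((50 + 3 * q) * D)
        double = begin
          2 * (n * n)                     ≡⟨ *-assoc 2 n n ⟨
          2 * n * n                       ≤⟨ *-monoˡ-≤ n n≤m ⟩
          5 * m * n                       ≤⟨ *-monoˡ-≤ n (*-monoʳ-≤ 5 m≤) ⟩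
          5 * (s + C) * n                 ≡⟨ expand s C n ⟩
          5 * (s * n + C * n)             ≤⟨ *-monoʳ-≤ 5 (+-mono-≤ sn≤D crossing) ⟩
          -- Padding by `q * D` turns 5 q into 6 q, so that the factor 2 can be cancelled.
          5 * (20 * D + q * D)            ≤⟨ m≤m+n _ (q * D) ⟩
          5 * (20 * D + q * D) + q * D    ≡⟨ collect D q ⟩
          2 * ((50 + 3 * q) * D)          ∎

      -- At least 2 n / 5 vertices move and at most n / 16 of them stay in the part, so C is at
      -- least (2/5 - 1/16) n = 27 n / 80.
      many-crossings : ∀ {s m} → m ≤ s + C → 2 * n ≤ 5 * m → 16 * s ≤ n → n * n ≤ K * D
      many-crossings {s} {m} m≤ n≤m s≤n = begin
        n * n           ≤⟨ *-monoˡ-≤ n n≤C ⟩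
        80 * C * n      ≡⟨ *-assoc 80 C n ⟩
        80 * (C * n)    ≤⟨ *-monoʳ-≤ 80 crossing ⟩
        80 * (q * D)    ≡⟨ *-assoc 80 q D ⟨
        80 * q * D      ≤⟨ *-monoˡ-≤ D {80 * q} {K} (≤-slack (80 * q) (176 * q + 256 * r + 256) (constants q r)) ⟩
        K * D           ∎
        where
        constants : ∀ q r → 80 * q + (176 * q + 256 * r + 256) ≡ 256 * (q + r + 1)
        constants = solve-∀
        identity : ∀ n m s C → n + (16 * (5 * m) + 80 * (s + C) + 5 * n + 26 * n) ≡
                               80 * C + (16 * (2 * n) + 80 * m + 5 * (16 * s))
        identity = solve-∀
        n≤C : n ≤ 80 * C
        -- The weights 16, 80 and 5 give 27 n ≤ 80 C; the slack `26 * n` weakens this to n ≤ 80 C.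
        n≤C = ≤-by (26 * n)
          (+-mono-≤ (+-mono-≤ (*-monoʳ-≤ 16 n≤m) (*-monoʳ-≤ 80 m≤)) (*-monoʳ-≤ 5 s≤n))
          (identity n m s C)

      two-blocks : n + 1 ≤ 16 * s₀ → n + 1 ≤ 16 * s₁ → n * n ≤ K * D
      two-blocks n<s₀ n<s₁ = begin
        n * n                ≤⟨ *-mono-≤ (≤-trans (m≤m+n n 1) n<s₀) (≤-trans (m≤m+n n 1) n<s₁) ⟩
        16 * s₀ * (16 * s₁)  ≡⟨ identity s₀ s₁ ⟩
        256 * (s₀ * s₁)      ≤⟨ *-monoʳ-≤ 256 (blocks n<s₀ n<s₁) ⟩
        256 * (r * D)        ≡⟨ *-assoc 256 r D ⟨
        256 * r * D          ≤⟨ *-monoˡ-≤ D (*-monoʳ-≤ 256 (≤-trans (m≤n+m r q) (m≤m+n (q + r) 1))) ⟩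
        K * D                ∎
        where
        identity : ∀ a b → 16 * a * (16 * b) ≡ 256 * (a * b)
        identity = solve-∀

      weaken : ∀ {m} → 2 * (4 * n + 3) ≤ m → 2 * n ≤ m
      weaken = ≤-trans (*-monoʳ-≤ 2 (≤-trans (m≤n*m n 4) (m≤m+n (4 * n) 3)))

    moved-bound : (s₀ + s₁ + s₂ + C) * n ≤ 7 * K * D
    moved-bound with ≤-total (5 * m₂) (2 * (4 * n + 3)) | ≤-total (5 * m₀) (2 * n) | ≤-total (5 * m₁) (2 * n)
    -- The one case without a quadratic bound: moves within parts are paid for by rows and columns
    -- of B, and crossings by degrees.
    ... | inj₁ m₂-few | inj₁ m₀-few | _ = begin
      (s₀ + s₁ + s₂ + C) * n                ≡⟨ split s₀ s₁ s₂ C n ⟩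
      (s₀ + s₁) * n + s₂ * n + C * n        ≤⟨ +-mono-≤ (+-mono-≤ (rows m₂-few) (columns₀ m₀-few)) crossing ⟩
      20 * D + 20 * D + q * D               ≡⟨ collect D q ⟩
      (40 + q) * D                          ≤⟨ *-monoˡ-≤ D {40 + q} {7 * K}
                                                 (≤-slack (40 + q) (1791 * q + 1792 * r + 1752) (constants q r)) ⟩
      7 * K * D                             ∎
      where
      split : ∀ a b c d n → (a + b + c + d) * n ≡ (a + b) * n + c * n + d * n
      split = solve-∀
      collect : ∀ D q → 20 * D + 20 * D + q * D ≡ (40 + q) * D
      collect = solve-∀
      constants : ∀ q r → 40 + q + (1791 * q + 1792 * r + 1752) ≡ 7 * (256 * (q + r + 1))
      constants = solve-∀
    ... | inj₁ m₂-few | inj₂ m₀-many | _ =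
      quadratic (one-part m₀≤ m₀-many (≤-trans (*-monoˡ-≤ n (m≤m+n s₀ s₁)) (rows m₂-few)))
    ... | inj₂ m₂-many | inj₁ m₀-few | _ = quadratic (one-part m₂≤ (weaken m₂-many) (columns₀ m₀-few))
    ... | inj₂ m₂-many | inj₂ _ | inj₁ m₁-few = quadratic (one-part m₂≤ (weaken m₂-many) (columns₁ m₁-few))
    -- All parts are heavily moved, so fixed vertices no longer expose the moves. The threshold n /
    -- 16 separates many crossings from sets large enough to carry k-sources.
    ... | inj₂ _ | inj₂ m₀-many | inj₂ m₁-many with ≤-<-connex (16 * s₀) n | ≤-<-connex (16 * s₁) n
    ...   | inj₁ s₀-few  | _            = quadratic (many-crossings m₀≤ m₀-many s₀-few)
    ...   | inj₂ _       | inj₁ s₁-few  = quadratic (many-crossings m₁≤ m₁-many s₁-few)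
    ...   | inj₂ s₀-many | inj₂ s₁-many = quadratic (two-blocks (above s₀-many) (above s₁-many))
      where
      -- The off-by-one matters: `n + 1` will be 2 ^ ℓ, so 16 s > n means that s is at least 2 ^ (ℓ
      -- - 4).
      above : ∀ {m} → n < m → n + 1 ≤ m
      above {m} = subst (_≤ m) (+-comm 1 n)

  -- Finite sums and counts of naturals.

  sumℕ≡sum : ∀ n (f : Fin n → ℕ) → sumℕ n f ≡ sum f
  sumℕ≡sum zero    f = refl
  sumℕ≡sum (suc n) f = cong (f zero +_) (sumℕ≡sum n (f ∘ suc))

  sumℕ-cong : ∀ n {f g : Fin n → ℕ} → (∀ i → f i ≡ g i) → sumℕ n f ≡ sumℕ n g
  sumℕ-cong zero    f≗g = refl
  sumℕ-cong (suc n) f≗g = cong₂ _+_ (f≗g zero) (sumℕ-cong n (f≗g ∘ suc))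

  sumℕ-mono : ∀ n {f g : Fin n → ℕ} → (∀ i → f i ≤ g i) → sumℕ n f ≤ sumℕ n g
  sumℕ-mono zero    f≤g = z≤n
  sumℕ-mono (suc n) f≤g = +-mono-≤ (f≤g zero) (sumℕ-mono n (f≤g ∘ suc))

  sumℕ-+ : ∀ n (f g : Fin n → ℕ) → sumℕ n (λ i → f i + g i) ≡ sumℕ n f + sumℕ n g
  sumℕ-+ n f g = begin
    sumℕ n (λ i → f i + g i)  ≡⟨ sumℕ≡sum n _ ⟩
    sum (λ i → f i + g i)     ≡⟨ ∑-distrib-+ f g ⟩
    sum f + sum g             ≡⟨ cong₂ _+_ (sumℕ≡sum n f) (sumℕ≡sum n g) ⟨
    sumℕ n f + sumℕ n g       ∎
    where open ≡-Reasoning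

  sumℕ-*ˡ : ∀ n c (f : Fin n → ℕ) → sumℕ n (λ i → c * f i) ≡ c * sumℕ n f
  sumℕ-*ˡ n c f = begin
    sumℕ n (λ i → c * f i)  ≡⟨ sumℕ≡sum n _ ⟩
    sum (λ i → c * f i)     ≡⟨ *-distribˡ-sum c f ⟨
    c * sum f               ≡⟨ cong (c *_) (sumℕ≡sum n f) ⟨
    c * sumℕ n f            ∎
    where open ≡-Reasoning

  ind≤1 : ∀ b → ind b ≤ 1
  ind≤1 true  = ≤-refl
  ind≤1 false = z≤n

  countFin≤ : ∀ n (P : Fin n → Bool) → countFin n P ≤ n
  countFin≤ zero    P = z≤n
  countFin≤ (suc n) P = +-mono-≤ (ind≤1 (P zero)) (countFin≤ n (P ∘ suc))

  countFin-true : ∀ n → countFin n (λ _ → true) ≡ n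
  countFin-true zero    = refl
  countFin-true (suc n) = cong suc (countFin-true n)

  countFin-false : ∀ n → countFin n (λ _ → false) ≡ 0
  countFin-false zero    = refl
  countFin-false (suc n) = countFin-false n

  countFin-others : ∀ {n} (i : Fin n) → suc (countFin n (λ j → not (finEq i j))) ≡ n
  countFin-others {suc n} zero    = cong suc (countFin-true n)
  countFin-others {suc n} (suc i) = cong suc (countFin-others i)

  ind-weight : ∀ b {x y} → (b ≡ true → x ≤ y) → x * ind b ≤ y
  ind-weight true  {x} {y} x≤y = subst (_≤ y) (sym (*-identityʳ x)) (x≤y refl)
  ind-weight false {x} {y} _   = subst (_≤ y) (sym (*-zeroʳ x)) z≤n

  -- Turns a pointwise defect bound into a bound on the total: each counted index pays `x` out of
  -- its own summand.
  countFin-weight : ∀ n {P : Fin n → Bool} {f : Fin n → ℕ} x c →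
                    (∀ i → P i ≡ true → x ≤ c * f i) → countFin n P * x ≤ c * sumℕ n f
  countFin-weight n {P} {f} x c x≤f = begin
    countFin n P * x             ≡⟨ *-comm _ x ⟩
    x * countFin n P             ≡⟨ sumℕ-*ˡ n x _ ⟨
    sumℕ n (λ i → x * ind (P i)) ≤⟨ sumℕ-mono n (λ i → ind-weight (P i) (x≤f i)) ⟩
    sumℕ n (λ i → c * f i)       ≡⟨ sumℕ-*ˡ n c f ⟩
    c * sumℕ n f                 ∎
    where open ≤-Reasoning

  sumℕ-splitAt : ∀ m {n} (h : Fin m ⊎ Fin n → ℕ) →
                 sumℕ (m + n) (h ∘ splitAt m) ≡ sumℕ m (h ∘ inj₁) + sumℕ n (h ∘ inj₂)
  sumℕ-splitAt zero    h = refl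
  sumℕ-splitAt (suc m) h = trans
    (cong (h (inj₁ zero) +_) (sumℕ-splitAt m (h ∘ Sum.map₁ suc)))
    (sym (+-assoc (h (inj₁ zero)) _ _))

  -- Sums over the vertex set.

  module VertexSums (ℓ : ℕ) where
    private
      n = 2 ^ ℓ ∸ 1
      M = 2 ^ (ℓ + 2) ∸ 1

    -- Flattens the three parts into one `Fin`, where the general facts on sums and permutations
    -- apply.
    index↔ : Fin (n + (n + M)) ↔ Vtx ℓ
    index↔ = (↔-id (Fin n) ⊎-↔ FinP.+↔⊎) ↔-∘ FinP.+↔⊎

    sumVtx-index : (h : Vtx ℓ → ℕ) → sumVtx ℓ h ≡ sumℕ (n + (n + M)) (h ∘ Inverse.to index↔)
    sumVtx-index h = begin
      sumℕ n (h ∘ inj₁) + sumℕ n (h ∘ inj₂ ∘ inj₁) + sumℕ M (h ∘ inj₂ ∘ inj₂)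
        ≡⟨ +-assoc (sumℕ n (h ∘ inj₁)) _ _ ⟩
      sumℕ n (h ∘ inj₁) + (sumℕ n (h ∘ inj₂ ∘ inj₁) + sumℕ M (h ∘ inj₂ ∘ inj₂))
        ≡⟨ cong (sumℕ n (h ∘ inj₁) +_) (sumℕ-splitAt n (h ∘ inj₂)) ⟨
      sumℕ n (h ∘ inj₁) + sumℕ (n + M) (h ∘ inj₂ ∘ splitAt n)
        ≡⟨ sumℕ-splitAt n (h ∘ Sum.map₂ (splitAt n)) ⟨
      sumℕ (n + (n + M)) (h ∘ Inverse.to index↔) ∎
      where open ≡-Reasoning

    -- Conjugating `π` by `index↔` gives a permutation of a `Fin`, under which sums are invariant.
    sumVtx-permute : (π : Vtx ℓ ↔ Vtx ℓ) (h : Vtx ℓ → ℕ) → sumVtx ℓ (h ∘ Inverse.to π) ≡ sumVtx ℓ h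
    sumVtx-permute π h = begin
      sumVtx ℓ (h ∘ Inverse.to π)
        ≡⟨ sumVtx-index (h ∘ Inverse.to π) ⟩
      sumℕ (n + (n + M)) (h ∘ Inverse.to π ∘ Inverse.to index↔)
        ≡⟨ sumℕ-cong (n + (n + M)) (λ i →
           cong h (Inverse.strictlyInverseˡ index↔ (Inverse.to π (Inverse.to index↔ i)))) ⟨
      sumℕ (n + (n + M)) (h ∘ Inverse.to index↔ ∘ Inverse.to σ)
        ≡⟨ sumℕ≡sum (n + (n + M)) _ ⟩
      sum (h ∘ Inverse.to index↔ ∘ Inverse.to σ)
        ≡⟨ sum-permute (h ∘ Inverse.to index↔) σ ⟨
      sum (h ∘ Inverse.to index↔)
        ≡⟨ sumℕ≡sum (n + (n + M)) _ ⟨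
      sumℕ (n + (n + M)) (h ∘ Inverse.to index↔)
        ≡⟨ sumVtx-index h ⟨
      sumVtx ℓ h ∎
      where
      open ≡-Reasoning
      σ = ↔-sym index↔ ↔-∘ (π ↔-∘ index↔)

    sumVtx-cong : {f g : Vtx ℓ → ℕ} → (∀ v → f v ≡ g v) → sumVtx ℓ f ≡ sumVtx ℓ g
    sumVtx-cong {f} {g} f≗g = trans (sumVtx-index f)
      (trans (sumℕ-cong (n + (n + M)) (f≗g ∘ Inverse.to index↔)) (sym (sumVtx-index g)))

    sumVtx-mono : {f g : Vtx ℓ → ℕ} → (∀ v → f v ≤ g v) → sumVtx ℓ f ≤ sumVtx ℓ g
    sumVtx-mono {f} {g} f≤g = subst₂ _≤_ (sym (sumVtx-index f)) (sym (sumVtx-index g))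
      (sumℕ-mono (n + (n + M)) (f≤g ∘ Inverse.to index↔))

    sumVtx-+ : (f g : Vtx ℓ → ℕ) → sumVtx ℓ (λ v → f v + g v) ≡ sumVtx ℓ f + sumVtx ℓ g
    sumVtx-+ f g = begin
      sumVtx ℓ (λ v → f v + g v)
        ≡⟨ sumVtx-index (λ v → f v + g v) ⟩
      sumℕ (n + (n + M)) (λ i → f (Inverse.to index↔ i) + g (Inverse.to index↔ i))
        ≡⟨ sumℕ-+ (n + (n + M)) _ _ ⟩
      sumℕ (n + (n + M)) (f ∘ Inverse.to index↔) + sumℕ (n + (n + M)) (g ∘ Inverse.to index↔)
        ≡⟨ cong₂ _+_ (sumVtx-index f) (sumVtx-index g) ⟨
      sumVtx ℓ f + sumVtx ℓ g ∎
      where open ≡-Reasoning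

    countVtx-weight : {P : Vtx ℓ → Bool} {f : Vtx ℓ → ℕ} → ∀ x c →
                      (∀ v → P v ≡ true → x ≤ c * f v) → sumVtx ℓ (ind ∘ P) * x ≤ c * sumVtx ℓ f
    countVtx-weight {P} {f} x c x≤f =
      subst₂ (λ a b → a * x ≤ c * b) (sym (sumVtx-index (ind ∘ P))) (sym (sumVtx-index f))
        (countFin-weight (n + (n + M)) x c (x≤f ∘ Inverse.to index↔))

    countVtx≤ : (P : Vtx ℓ → Bool) → sumVtx ℓ (ind ∘ P) ≤ n + (n + M)
    countVtx≤ P = subst (_≤ n + (n + M)) (sym (sumVtx-index (ind ∘ P))) (countFin≤ (n + (n + M)) _)

  -- Sizes of the vertex sets and target degree bounds.

  predecessor : ∀ ℓ → 2 ^ ℓ ∸ 1 + 1 ≡ 2 ^ ℓ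
  predecessor ℓ = m∸n+n≡m (m^n>0 2 ℓ)

  predecessor-odd : ∀ ℓ → 1 ≤ ℓ → Σ ℕ λ h → 2 ^ ℓ ∸ 1 ≡ 2 * h + 1
  predecessor-odd (suc ℓ) _ = 2 ^ ℓ ∸ 1 , (begin
    2 * 2 ^ ℓ ∸ 1                  ≡⟨ cong (λ x → 2 * x ∸ 1) (predecessor ℓ) ⟨
    2 * (2 ^ ℓ ∸ 1 + 1) ∸ 1        ≡⟨ cong (_∸ 1) (identity (2 ^ ℓ ∸ 1)) ⟩
    2 * (2 ^ ℓ ∸ 1) + 1 + 1 ∸ 1    ≡⟨ m+n∸n≡m (2 * (2 ^ ℓ ∸ 1) + 1) 1 ⟩
    2 * (2 ^ ℓ ∸ 1) + 1            ∎)
    where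
    open ≡-Reasoning
    identity : ∀ h → 2 * (h + 1) ≡ 2 * h + 1 + 1
    identity = solve-∀

  V₂-size : ∀ ℓ → 2 ^ (ℓ + 2) ∸ 1 ≡ 4 * (2 ^ ℓ ∸ 1) + 3
  V₂-size ℓ = begin
    2 ^ (ℓ + 2) ∸ 1                ≡⟨ cong (_∸ 1) (^-distribˡ-+-* 2 ℓ 2) ⟩
    2 ^ ℓ * 4 ∸ 1                  ≡⟨ cong (λ x → x * 4 ∸ 1) (predecessor ℓ) ⟨
    (2 ^ ℓ ∸ 1 + 1) * 4 ∸ 1        ≡⟨ cong (_∸ 1) (identity (2 ^ ℓ ∸ 1)) ⟩
    4 * (2 ^ ℓ ∸ 1) + 3 + 1 ∸ 1    ≡⟨ m+n∸n≡m (4 * (2 ^ ℓ ∸ 1) + 3) 1 ⟩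
    4 * (2 ^ ℓ ∸ 1) + 3            ∎
    where
    open ≡-Reasoning
    identity : ∀ n → (n + 1) * 4 ≡ 4 * n + 3 + 1
    identity = solve-∀

  V-size : ∀ ℓ → 6 * 2 ^ ℓ ∸ 3 ≡ 6 * (2 ^ ℓ ∸ 1) + 3
  V-size ℓ = begin
    6 * 2 ^ ℓ ∸ 3                  ≡⟨ cong (λ x → 6 * x ∸ 3) (predecessor ℓ) ⟨
    6 * (2 ^ ℓ ∸ 1 + 1) ∸ 3        ≡⟨ cong (_∸ 3) (identity (2 ^ ℓ ∸ 1)) ⟩
    6 * (2 ^ ℓ ∸ 1) + 3 + 3 ∸ 3    ≡⟨ m+n∸n≡m (6 * (2 ^ ℓ ∸ 1) + 3) 3 ⟩
    6 * (2 ^ ℓ ∸ 1) + 3            ∎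
    where
    open ≡-Reasoning
    identity : ∀ n → 6 * (n + 1) ≡ 6 * n + 3 + 3
    identity = solve-∀

  3≤predecessor : ∀ ℓ → 4 ≤ ℓ → 3 ≤ 2 ^ ℓ ∸ 1
  3≤predecessor ℓ 4≤ℓ = ∸-monoˡ-≤ 1 (≤-trans (m≤m+n 4 12) (^-monoʳ-≤ 2 4≤ℓ))

  -- The 4 in `k + 4 ≤ ℓ` pays for the threshold 16 = 2 ^ 4 of the case analysis.
  source-size : ∀ {ℓ k s} → k + 4 ≤ ℓ → 2 ^ ℓ ∸ 1 + 1 ≤ 16 * s → 2 ^ k ≤ s
  source-size {ℓ} {k} {s} k+4≤ℓ large = *-cancelˡ-≤ 16 (begin
    16 * 2 ^ k       ≡⟨ *-comm 16 (2 ^ k) ⟩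
    2 ^ k * 2 ^ 4    ≡⟨ ^-distribˡ-+-* 2 k 4 ⟨
    2 ^ (k + 4)      ≤⟨ ^-monoʳ-≤ 2 k+4≤ℓ ⟩
    2 ^ ℓ            ≡⟨ predecessor ℓ ⟨
    2 ^ ℓ ∸ 1 + 1    ≤⟨ large ⟩
    16 * s           ∎)
    where open ≤-Reasoning

  -- The number 36 n + 27 is 9 |V₂|, from rows of B of density at least 9/20. The target 0.3 |V|, in
  -- units of 1/20, is 36 n + 18.
  degree-lower : ∀ {n size d} → size ≡ 6 * n + 3 → 36 * n + 27 ≤ 20 * d → 3 * size ≤ 10 * d
  degree-lower {n} {d = d} refl d≥ = *-cancelˡ-≤ 2 (≤-by 9 d≥ (identity n d))
    where
    identity : ∀ n d → 2 * (3 * (6 * n + 3)) + (20 * d + 9) ≡ 2 * (10 * d) + (36 * n + 27)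
    identity = solve-∀

  degree-upper : ∀ {n size d} → size ≡ 6 * n + 3 → 20 * d ≤ 102 * n + 40 → 10 * d ≤ 9 * size
  degree-upper {n} {d = d} refl d≤ = *-cancelˡ-≤ 2 (≤-by (6 * n + 14) d≤ (identity n d))
    where
    identity : ∀ n d → 2 * (10 * d) + (102 * n + 40 + (6 * n + 14)) ≡ 2 * (9 * (6 * n + 3)) + 20 * d
    identity = solve-∀

  V₂-degree-lower : ∀ {n d} → 98 * n + 40 ≤ 20 * d → 36 * n + 27 ≤ 20 * d
  V₂-degree-lower {n} = ≤-trans (≤-slack _ (62 * n + 13) (identity n))
    where
    identity : ∀ n → 36 * n + 27 + (62 * n + 13) ≡ 98 * n + 40
    identity = solve-∀

  V₀₁-degree-upper : ∀ {n d} → 20 * d ≤ 84 * n + 33 → 20 * d ≤ 102 * n + 40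
  V₀₁-degree-upper {n} d≤ = ≤-trans d≤ (≤-slack _ (18 * n + 7) (identity n))
    where
    identity : ∀ n → 84 * n + 33 + (18 * n + 7) ≡ 102 * n + 40
    identity = solve-∀

  -- Passes from n to |V| at the cost of a factor 7, as 6 n + 3 ≤ 7 n.
  size-weight : ∀ {n size t K D} → size ≡ 6 * n + 3 → 3 ≤ n → t * n ≤ K * D → size * t ≤ 7 * K * D
  size-weight {n} {t = t} {K} {D} refl 3≤n tn≤ = begin
    (6 * n + 3) * t    ≤⟨ *-monoˡ-≤ t (+-monoʳ-≤ (6 * n) 3≤n) ⟩
    (6 * n + n) * t    ≡⟨ identity n t ⟩
    7 * (t * n)        ≤⟨ *-monoʳ-≤ 7 tn≤ ⟩
    7 * (K * D)        ≡⟨ *-assoc 7 K D ⟨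
    7 * K * D          ∎
    where
    open ≤-Reasoning
    identity : ∀ n t → (6 * n + n) * t ≡ 7 * (t * n)
    identity = solve-∀

  -- Near-half counts and gaps between degrees.

  -- The condition within ½ (ε′ / 10) m x for ε′ = P / Q, with denominators cleared.
  record NearHalf (P Q m x : ℕ) : Set where
    field
      upper : 10 * Q * x ≤ 5 * Q * m + P * m
      lower : 5 * Q * m ≤ 10 * Q * x + P * m

  open NearHalf public

  module Fraction {P Q : ℕ} .{{_ : NonZero P}} .{{_ : NonZero Q}} (2P≤Q : 2 * P ≤ Q) where

    -- As ε′ ≤ 1/2, the error (ε′ / 10) m is at most m / 20.
    nearHalf-lower : ∀ {m x} → NearHalf P Q m x → 9 * m ≤ 20 * x
    nearHalf-lower {m} {x} h = *-cancelˡ-≤ Q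
      (≤-by 0 (+-mono-≤ (*-monoʳ-≤ 2 (lower h)) (*-monoˡ-≤ m 2P≤Q)) (identity P Q m x))
      where
      identity : ∀ P Q m x → Q * (9 * m) + (2 * (10 * Q * x + P * m) + Q * m + 0) ≡
                             Q * (20 * x) + (2 * (5 * Q * m) + 2 * P * m)
      identity = solve-∀

    nearHalf-upper : ∀ {m x} → NearHalf P Q m x → 20 * x ≤ 11 * m
    nearHalf-upper {m} {x} h = *-cancelˡ-≤ Q
      (≤-by 0 (+-mono-≤ (*-monoʳ-≤ 2 (upper h)) (*-monoˡ-≤ m 2P≤Q)) (identity P Q m x))
      where
      identity : ∀ P Q m x → Q * (20 * x) + (2 * (5 * Q * m + P * m) + Q * m + 0) ≡
                             Q * (11 * m) + (2 * (10 * Q * x) + 2 * P * m)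
      identity = solve-∀

    -- An integer misses half of an odd m by at least 1/2, on whichever side of it `x` lies, so the
    -- allowed error (ε′ / 10) m is at least 1/2.
    nearHalf-odd : ∀ {m x} h → m ≡ 2 * h + 1 → NearHalf P Q m x → 5 * Q ≤ P * m
    nearHalf-odd {x = x} h refl near with ≤-<-connex x h
    ... | inj₁ x≤h = ≤-by 0 (+-mono-≤ (lower near) (*-monoʳ-≤ (10 * Q) x≤h)) (identity P Q h x)
      where
      identity : ∀ P Q h x → 5 * Q + (10 * Q * x + P * (2 * h + 1) + 10 * Q * h + 0) ≡
                             P * (2 * h + 1) + (5 * Q * (2 * h + 1) + 10 * Q * x)
      identity = solve-∀
    ... | inj₂ h<x = ≤-by 0 (+-mono-≤ (upper near) (*-monoʳ-≤ (10 * Q) h<x)) (identity P Q h x)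
      where
      identity : ∀ P Q h x → 5 * Q + (5 * Q * (2 * h + 1) + P * (2 * h + 1) + 10 * Q * x + 0) ≡
                             P * (2 * h + 1) + (10 * Q * x + 10 * Q * suc h)
      identity = solve-∀

    -- After division by 10 Q: the gain `e` exceeds ε′ (n + 1), the errors of the two rows of B cost
    -- at most 2 (ε′ / 10) (4 n + 3), and the clique on V₁ supplies `o` = n - 1 against `c` ≤ n. The
    -- difference of degrees thus exceeds 0.2 ε′ n + 0.4 ε′ - 1, and the loss of 1 has to be
    -- absorbed.
    degree-gap₀₁ : ∀ {n M o c b e b′} → suc o ≡ n → M ≡ 4 * n + 3 → 5 * Q ≤ P * n → c ≤ n →
                   P * (n + 1) < Q * e → NearHalf P Q M b → NearHalf P Q M b′ →
                   10 * Q * (c + b) + n ≤ 10 * Q * (e + o + b′)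
    degree-gap₀₁ {o = o} {c} {b} {e} {b′} refl refl 5Q≤Pn c≤n e> b-near b′-near = *-cancelˡ-≤ 2
      -- Twice the difference is bounded by adding `combined`, worth 0.2 ε′ n - 1, to `degrees<`,
      -- worth 1. The difference is then at least ε′ n / 10, hence at least n / (10 Q) because P ≥
      -- 1.
      (≤-by (4 * P + 10)
        (+-mono-≤ (+-mono-≤ combined (*-monoʳ-≤ (10 * Q) degrees<))
                  (*-monoʳ-≤ 2 (*-monoˡ-≤ (suc o) (ℕ.>-nonZero⁻¹ P))))
        (identity₂ P Q c b e b′ o))
      where
      combined : 10 * Q * b + 5 * Q * (4 * suc o + 3) + 10 * suc (P * (suc o + 1)) + 10 * Q * c ≤
                 (5 * Q * (4 * suc o + 3) + P * (4 * suc o + 3)) + (10 * Q * b′ + P * (4 * suc o + 3)) +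
                   10 * (Q * e) + 10 * Q * suc o
      combined = +-mono-≤ (+-mono-≤ (+-mono-≤ (upper b-near) (lower b′-near)) (*-monoʳ-≤ 10 e>))
                          (*-monoʳ-≤ (10 * Q) c≤n)
      identity₁ : ∀ P Q c b e b′ o →
        suc (10 * Q * (c + b)) +
          (((5 * Q * (4 * suc o + 3) + P * (4 * suc o + 3)) + (10 * Q * b′ + P * (4 * suc o + 3)) +
              10 * (Q * e) + 10 * Q * suc o + 2 * (P * suc o)) + (4 * P + 9)) ≡
        10 * Q * (e + o + b′) +
          ((10 * Q * b + 5 * Q * (4 * suc o + 3) + 10 * suc (P * (suc o + 1)) + 10 * Q * c) + 2 * (5 * Q))
      identity₁ = solve-∀
      -- By `5Q≤Pn`, 0.2 ε′ n is at least 1, so the difference is positive; being an integer, it is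
      -- at least 1.
      degrees< : c + b < e + o + b′
      degrees< = *-cancelˡ-< (10 * Q) (c + b) (e + o + b′)
        (≤-by (4 * P + 9) (+-mono-≤ combined (*-monoʳ-≤ 2 5Q≤Pn)) (identity₁ P Q c b e b′ o))
      identity₂ : ∀ P Q c b e b′ o →
        2 * (10 * Q * (c + b) + suc o) +
          (((5 * Q * (4 * suc o + 3) + P * (4 * suc o + 3)) + (10 * Q * b′ + P * (4 * suc o + 3)) +
              10 * (Q * e) + 10 * Q * suc o + 10 * Q * (e + o + b′) + 2 * (P * suc o)) + (4 * P + 10)) ≡
        2 * (10 * Q * (e + o + b′)) +
          ((10 * Q * b + 5 * Q * (4 * suc o + 3) + 10 * suc (P * (suc o + 1)) + 10 * Q * c) +
              10 * Q * suc (c + b) + 2 * (1 * suc o))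
      identity₂ = solve-∀

    -- The degrees differ by at least (14 n + 7) / 20. The factor Q only brings the gap to the same
    -- scale as `degree-gap₀₁`.
    degree-gap₂ : ∀ {n d d₂} → 20 * d ≤ 84 * n + 33 → 98 * n + 40 ≤ 20 * d₂ → 10 * Q * d + n ≤ 10 * Q * d₂
    degree-gap₂ {n} {d} {d₂} d≤ ≤d₂ = begin
      10 * Q * d + n        ≤⟨ +-monoʳ-≤ (10 * Q * d) (m≤n*m n Q) ⟩
      10 * Q * d + Q * n    ≡⟨ factor Q d n ⟩
      Q * (10 * d + n)      ≤⟨ *-monoʳ-≤ Q (*-cancelˡ-≤ 2 (≤-by (12 * n + 7) (+-mono-≤ d≤ ≤d₂) (identity n d d₂))) ⟩
      Q * (10 * d₂)         ≡⟨ swap Q d₂ ⟩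
      10 * Q * d₂           ∎
      where
      open ≤-Reasoning
      factor : ∀ Q d n → 10 * Q * d + Q * n ≡ Q * (10 * d + n)
      factor = solve-∀
      swap : ∀ Q d → Q * (10 * d) ≡ 10 * Q * d
      swap = solve-∀
      identity : ∀ n d d₂ → 2 * (10 * d + n) + (84 * n + 33 + 20 * d₂ + (12 * n + 7)) ≡
                            2 * (10 * d₂) + (20 * d + (98 * n + 40))
      identity = solve-∀

  -- Degrees are bounded through 20 · degree, with |V₂| = 4 n + 3 and n = |V₀| = |V₁|.
  degree₀-lower : ∀ {n M b} c → M ≡ 4 * n + 3 → 9 * M ≤ 20 * b → 36 * n + 27 ≤ 20 * (c + b)
  degree₀-lower {n} {b = b} c refl b≥ = ≤-by (20 * c) b≥ (identity n c b)
    where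
    identity : ∀ n c b → 36 * n + 27 + (20 * b + 20 * c) ≡ 20 * (c + b) + 9 * (4 * n + 3)
    identity = solve-∀

  degree₀-upper : ∀ {n M b c} → M ≡ 4 * n + 3 → c ≤ n → 20 * b ≤ 11 * M → 20 * (c + b) ≤ 84 * n + 33
  -- The sum is at most 64 n + 33; the slack `20 * n` relaxes it to a bound shared with V₁, whose
  -- clique adds n - 1 neighbours.
  degree₀-upper {n} {b = b} {c} refl c≤n b≤ = ≤-by (20 * n) (+-mono-≤ (*-monoʳ-≤ 20 c≤n) b≤) (identity n c b)
    where
    identity : ∀ n c b → 20 * (c + b) + (20 * n + 11 * (4 * n + 3) + 20 * n) ≡
                         84 * n + 33 + (20 * c + 20 * b)
    identity = solve-∀

  degree₁-upper : ∀ {n M o b e} → suc o ≡ n → M ≡ 4 * n + 3 → e ≤ n → 20 * b ≤ 11 * M →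
                  20 * (e + o + b) ≤ 84 * n + 33
  degree₁-upper {o = o} {b} {e} refl refl e≤n b≤ = ≤-by 20 (+-mono-≤ (*-monoʳ-≤ 20 e≤n) b≤) (identity o e b)
    where
    identity : ∀ o e b → 20 * (e + o + b) + (20 * suc o + 11 * (4 * suc o + 3) + 20) ≡
                         84 * suc o + 33 + (20 * e + 20 * b)
    identity = solve-∀

  -- A vertex of V₂ sees the same column of B in V₀ and in V₁, and `o` = 4 n + 2 clique neighbours:
  -- 98 n + 40 is 2 · 9 n + 20 (4 n + 2).
  degree₂-lower : ∀ {n M o b} → suc o ≡ M → M ≡ 4 * n + 3 → 9 * n ≤ 20 * b → 98 * n + 40 ≤ 20 * (b + b + o)
  degree₂-lower {n} {o = o} {b} refl M≡ b≥ =
    ≤-by 0 (+-mono-≤ (+-mono-≤ b≥ b≥) (*-monoʳ-≤ 20 (≤-reflexive (sym M≡)))) (identity n b o)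
    where
    identity : ∀ n b o → 98 * n + 40 + (20 * b + 20 * b + 20 * suc o + 0) ≡
                         20 * (b + b + o) + (9 * n + 9 * n + 20 * (4 * n + 3))
    identity = solve-∀

  degree₂-upper : ∀ {n M o b} → suc o ≡ M → M ≡ 4 * n + 3 → 20 * b ≤ 11 * n → 20 * (b + b + o) ≤ 102 * n + 40
  degree₂-upper {n} {o = o} {b} refl M≡ b≤ =
    ≤-by 0 (+-mono-≤ (+-mono-≤ b≤ b≤) (*-monoʳ-≤ 20 (≤-reflexive M≡))) (identity n b o)
    where
    identity : ∀ n b o → 20 * (b + b + o) + (11 * n + 11 * n + 20 * (4 * n + 3) + 0) ≡
                         102 * n + 40 + (20 * b + 20 * b + 20 * suc o)
    identity = solve-∀

  -- Equality of vertices and the kinds of moves.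

  ind-≤ : ∀ a b → ind a ≤ ind b + ind (not (a == b))
  ind-≤ true  true  = ≤-refl
  ind-≤ true  false = ≤-refl
  ind-≤ false b     = z≤n

  ind-≥ : ∀ a b → ind b ≤ ind a + ind (not (a == b))
  ind-≥ true  b     = ≤-trans (ind≤1 b) (m≤m+n 1 _)
  ind-≥ false true  = ≤-refl
  ind-≥ false false = ≤-refl

  finEq⇒≡ : ∀ {a} (i j : Fin a) → finEq i j ≡ true → i ≡ j
  finEq⇒≡ i j eq with i FinP.≟ j
  ... | yes i≡j = i≡j
  finEq⇒≡ i j () | no _

  finEq-refl : ∀ {a} (i : Fin a) → finEq i i ≡ true
  finEq-refl i with i FinP.≟ i
  ... | yes _   = refl
  ... | no  i≢i = contradiction refl i≢i

  not-finEq⇒≢ : ∀ {a} (i j : Fin a) → not (finEq i j) ≡ true → i ≢ j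
  not-finEq⇒≢ i .i eq refl with finEq i i | finEq-refl i
  not-finEq⇒≢ i .i () refl | true | _

  -- Tampering functions must be total and without fixed points, so a value equal to `i` is replaced
  -- by some other point.
  avoiding : ∀ {N} → 2 ≤ N → (i j : Fin N) → Σ (Fin N) λ j′ → j′ ≢ i × (j ≢ i → j ≡ j′)
  avoiding {suc (suc N)} _ i j with j FinP.≟ i
  ... | yes j≡i = punchIn i zero , FinP.punchInᵢ≢i i zero , λ j≢i → contradiction j≡i j≢i
  ... | no  j≢i = j , j≢i , λ _ → refl
  avoiding {suc zero} (s≤s ()) i j

  module VertexMoves (ℓ : ℕ) where
    private
      n = 2 ^ ℓ ∸ 1
      M = 2 ^ (ℓ + 2) ∸ 1

    movedWithin changedPart : Vtx ℓ → Vtx ℓ → Bool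
    movedWithin (inj₁ i)        (inj₁ j)        = not (finEq i j)
    movedWithin (inj₂ (inj₁ i)) (inj₂ (inj₁ j)) = not (finEq i j)
    movedWithin (inj₂ (inj₂ i)) (inj₂ (inj₂ j)) = not (finEq i j)
    movedWithin _               _               = false
    changedPart (inj₁ _)        (inj₁ _)        = false
    changedPart (inj₂ (inj₁ _)) (inj₂ (inj₁ _)) = false
    changedPart (inj₂ (inj₂ _)) (inj₂ (inj₂ _)) = false
    changedPart _               _               = true

    moved-split : ∀ w v → ind (not (vtxEq ℓ w v)) ≡ ind (movedWithin w v) + ind (changedPart w v)
    moved-split (inj₁ i)        (inj₁ j)        = sym (+-identityʳ _)
    moved-split (inj₁ i)        (inj₂ (inj₁ j)) = refl
    moved-split (inj₁ i)        (inj₂ (inj₂ j)) = refl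
    moved-split (inj₂ (inj₁ i)) (inj₁ j)        = refl
    moved-split (inj₂ (inj₁ i)) (inj₂ (inj₁ j)) = sym (+-identityʳ _)
    moved-split (inj₂ (inj₁ i)) (inj₂ (inj₂ j)) = refl
    moved-split (inj₂ (inj₂ i)) (inj₁ j)        = refl
    moved-split (inj₂ (inj₂ i)) (inj₂ (inj₁ j)) = refl
    moved-split (inj₂ (inj₂ i)) (inj₂ (inj₂ j)) = sym (+-identityʳ _)

    vtxEq⇒≡ : ∀ u v → vtxEq ℓ u v ≡ true → u ≡ v
    vtxEq⇒≡ (inj₁ i)        (inj₁ j)        eq = cong inj₁ (finEq⇒≡ i j eq)
    vtxEq⇒≡ (inj₂ (inj₁ i)) (inj₂ (inj₁ j)) eq = cong (inj₂ ∘ inj₁) (finEq⇒≡ i j eq)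
    vtxEq⇒≡ (inj₂ (inj₂ i)) (inj₂ (inj₂ j)) eq = cong (inj₂ ∘ inj₂) (finEq⇒≡ i j eq)

    vtxEq-refl : ∀ v → vtxEq ℓ v v ≡ true
    vtxEq-refl (inj₁ i)        = finEq-refl i
    vtxEq-refl (inj₂ (inj₁ i)) = finEq-refl i
    vtxEq-refl (inj₂ (inj₂ i)) = finEq-refl i

    vtxEq-⇔ : ∀ {u v u′ v′} → (u ≡ v → u′ ≡ v′) → (u′ ≡ v′ → u ≡ v) → vtxEq ℓ u v ≡ vtxEq ℓ u′ v′
    vtxEq-⇔ {u} {v} {u′} {v′} to from with vtxEq ℓ u v in eq | vtxEq ℓ u′ v′ in eq′
    ... | true  | true  = refl
    ... | false | false = refl
    ... | true  | false = trans (sym (trans (cong (vtxEq ℓ u′) (sym (to (vtxEq⇒≡ u v eq)))) (vtxEq-refl u′))) eq′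
    ... | false | true  = trans (sym eq) (trans (cong (vtxEq ℓ u) (sym (from (vtxEq⇒≡ u′ v′ eq′)))) (vtxEq-refl u))

    -- The value at `i` of a tampering function on V₀: the true image `w` when the vertex moves
    -- within V₀, and a dummy different from `i` otherwise.
    image₀ : 2 ≤ n → (i : Fin n) (w : Vtx ℓ) →
             Σ (Fin n) λ j → j ≢ i × (movedWithin w (inj₁ i) ≡ true → w ≡ inj₁ j)
    image₀ 2≤n i (inj₁ j) with avoiding 2≤n i j
    ... | j′ , j′≢i , keep = j′ , j′≢i , λ moved → cong inj₁ (keep (not-finEq⇒≢ j i moved))
    image₀ 2≤n i (inj₂ (inj₁ w)) with avoiding 2≤n i i
    ... | j′ , j′≢i , _ = j′ , j′≢i , λ ()
    image₀ 2≤n i (inj₂ (inj₂ w)) with avoiding 2≤n i i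
    ... | j′ , j′≢i , _ = j′ , j′≢i , λ ()

    image₁ : 2 ≤ n → (i : Fin n) (w : Vtx ℓ) →
             Σ (Fin n) λ j → j ≢ i × (movedWithin w (inj₂ (inj₁ i)) ≡ true → w ≡ inj₂ (inj₁ j))
    image₁ 2≤n i (inj₂ (inj₁ j)) with avoiding 2≤n i j
    ... | j′ , j′≢i , keep = j′ , j′≢i , λ moved → cong (inj₂ ∘ inj₁) (keep (not-finEq⇒≢ j i moved))
    image₁ 2≤n i (inj₁ w) with avoiding 2≤n i i
    ... | j′ , j′≢i , _ = j′ , j′≢i , λ ()
    image₁ 2≤n i (inj₂ (inj₂ w)) with avoiding 2≤n i i
    ... | j′ , j′≢i , _ = j′ , j′≢i , λ ()

  -- Degrees and neighbourhoods in the graph.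

  module Graph (ℓ : ℕ)
    (E : Fin (2 ^ ℓ ∸ 1) → Fin (2 ^ ℓ ∸ 1) → Bool)
    (B : Fin (2 ^ ℓ ∸ 1) → Fin (2 ^ (ℓ + 2) ∸ 1) → Bool)
    {P Q : ℕ} .{{_ : NonZero P}} .{{_ : NonZero Q}} (2P≤Q : 2 * P ≤ Q)
    (E-dense : ∀ i → P * (2 ^ ℓ ∸ 1 + 1) < Q * countFin (2 ^ ℓ ∸ 1) (E i))
    (B-rows : ∀ i → NearHalf P Q (2 ^ (ℓ + 2) ∸ 1) (countFin (2 ^ (ℓ + 2) ∸ 1) (B i)))
    (B-columns : ∀ k → NearHalf P Q (2 ^ ℓ ∸ 1) (countFin (2 ^ ℓ ∸ 1) (λ i → B i k)))
    (B-rows-differ : ∀ i i′ → i ≢ i′ →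
      NearHalf P Q (2 ^ (ℓ + 2) ∸ 1) (countFin (2 ^ (ℓ + 2) ∸ 1) (λ k → not (B i k == B i′ k))))
    (B-columns-differ : ∀ k k′ → k ≢ k′ →
      NearHalf P Q (2 ^ ℓ ∸ 1) (countFin (2 ^ ℓ ∸ 1) (λ i → not (B i k == B i k′))))
    (4≤ℓ : 4 ≤ ℓ)
    where

    open Fraction {P} {Q} 2P≤Q
    open VertexSums ℓ
    open VertexMoves ℓ

    private
      n = 2 ^ ℓ ∸ 1
      M = 2 ^ (ℓ + 2) ∸ 1
      M≡ = V₂-size ℓ
      3≤n = 3≤predecessor ℓ 4≤ℓ
      odd = predecessor-odd ℓ (≤-trans (s≤s z≤n) 4≤ℓ)

    private
      G = graphG ℓ E B
      Adj = adjG ℓ E B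
      deg = degree G

    deg₀ : ∀ j → deg (inj₁ j) ≡ countFin n (λ i → E i j) + countFin M (B j)
    deg₀ j = cong (λ z → z + countFin n (λ i → E i j) + countFin M (B j)) (countFin-false n)

    -- Any column of B shows this, since n is odd; the column of index 0 exists because |V₂| ≥ 3.
    5Q≤Pn : 5 * Q ≤ P * n
    5Q≤Pn = nearHalf-odd (proj₁ odd) (proj₂ odd)
      (B-columns (fromℕ< {0} (subst (0 <_) (sym M≡) (≤-trans (s≤s z≤n) (m≤n+m 3 (4 * n))))))

    deg₀-lower : ∀ j → 36 * n + 27 ≤ 20 * deg (inj₁ j)
    deg₀-lower j rewrite deg₀ j = degree₀-lower {n} (countFin n (λ i → E i j)) M≡ (nearHalf-lower (B-rows j))

    deg₀-upper : ∀ j → 20 * deg (inj₁ j) ≤ 84 * n + 33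
    deg₀-upper j rewrite deg₀ j = degree₀-upper {n} M≡ (countFin≤ n (λ i → E i j)) (nearHalf-upper (B-rows j))

    deg₁-lower : ∀ i → 36 * n + 27 ≤ 20 * deg (inj₂ (inj₁ i))
    deg₁-lower i = degree₀-lower {n} (countFin n (E i) + countFin n (λ i′ → not (finEq i i′))) M≡
      (nearHalf-lower (B-rows i))

    deg₁-upper : ∀ i → 20 * deg (inj₂ (inj₁ i)) ≤ 84 * n + 33
    deg₁-upper i = degree₁-upper (countFin-others i) M≡ (countFin≤ n (E i)) (nearHalf-upper (B-rows i))

    deg₂-lower : ∀ k → 98 * n + 40 ≤ 20 * deg (inj₂ (inj₂ k))
    deg₂-lower k = degree₂-lower {n} {b = countFin n (λ i → B i k)} (countFin-others k) M≡ (nearHalf-lower (B-columns k))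

    deg₂-upper : ∀ k → 20 * deg (inj₂ (inj₂ k)) ≤ 102 * n + 40
    deg₂-upper k = degree₂-upper {n} {b = countFin n (λ i → B i k)} (countFin-others k) M≡ (nearHalf-upper (B-columns k))

    -- A vertex of V₁ sees a row of `E`, dense by hypothesis, while a vertex of V₀ sees a column of
    -- `E`, bounded only by n.
    gap₀₁ : ∀ j i → 10 * Q * deg (inj₁ j) + n ≤ 10 * Q * deg (inj₂ (inj₁ i))
    gap₀₁ j i rewrite deg₀ j =
      degree-gap₀₁ {n} (countFin-others i) M≡ 5Q≤Pn (countFin≤ n (λ i → E i j)) (E-dense i) (B-rows j) (B-rows i)

    part-gap : ∀ v w → changedPart w v ≡ true →
               10 * Q * deg v + n ≤ 10 * Q * deg w ⊎ 10 * Q * deg w + n ≤ 10 * Q * deg v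
    part-gap (inj₁ j)        (inj₂ (inj₁ i)) _ = inj₁ (gap₀₁ j i)
    part-gap (inj₁ j)        (inj₂ (inj₂ k)) _ = inj₁ (degree-gap₂ (deg₀-upper j) (deg₂-lower k))
    part-gap (inj₂ (inj₁ i)) (inj₁ j)        _ = inj₂ (gap₀₁ j i)
    part-gap (inj₂ (inj₁ i)) (inj₂ (inj₂ k)) _ = inj₁ (degree-gap₂ (deg₁-upper i) (deg₂-lower k))
    part-gap (inj₂ (inj₂ k)) (inj₁ j)        _ = inj₂ (degree-gap₂ (deg₀-upper j) (deg₂-lower k))
    part-gap (inj₂ (inj₂ k)) (inj₂ (inj₁ i)) _ = inj₂ (degree-gap₂ (deg₁-upper i) (deg₂-lower k))
    part-gap (inj₁ _)        (inj₁ _)        ()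
    part-gap (inj₂ (inj₁ _)) (inj₂ (inj₁ _)) ()
    part-gap (inj₂ (inj₂ _)) (inj₂ (inj₂ _)) ()

    rows-differ₀ : ∀ i w → movedWithin w (inj₁ i) ≡ true →
      9 * M ≤ 20 * countFin M (λ k → not (Adj (inj₁ i) (inj₂ (inj₂ k)) == Adj w (inj₂ (inj₂ k))))
    rows-differ₀ i (inj₁ i′) moved = nearHalf-lower (B-rows-differ i i′ (≢-sym (not-finEq⇒≢ i′ i moved)))
    rows-differ₀ _ (inj₂ (inj₁ _)) ()
    rows-differ₀ _ (inj₂ (inj₂ _)) ()

    rows-differ₁ : ∀ i w → movedWithin w (inj₂ (inj₁ i)) ≡ true →
      9 * M ≤ 20 * countFin M (λ k → not (Adj (inj₂ (inj₁ i)) (inj₂ (inj₂ k)) == Adj w (inj₂ (inj₂ k))))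
    rows-differ₁ i (inj₂ (inj₁ i′)) moved = nearHalf-lower (B-rows-differ i i′ (≢-sym (not-finEq⇒≢ i′ i moved)))
    rows-differ₁ _ (inj₁ _) ()
    rows-differ₁ _ (inj₂ (inj₂ _)) ()

    columns-differ₀ : ∀ k w → movedWithin w (inj₂ (inj₂ k)) ≡ true →
      9 * n ≤ 20 * countFin n (λ i → not (Adj (inj₂ (inj₂ k)) (inj₁ i) == Adj w (inj₁ i)))
    columns-differ₀ k (inj₂ (inj₂ k′)) moved = nearHalf-lower (B-columns-differ k k′ (≢-sym (not-finEq⇒≢ k′ k moved)))
    columns-differ₀ _ (inj₁ _) ()
    columns-differ₀ _ (inj₂ (inj₁ _)) ()

    columns-differ₁ : ∀ k w → movedWithin w (inj₂ (inj₂ k)) ≡ true →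
      9 * n ≤ 20 * countFin n (λ i → not (Adj (inj₂ (inj₂ k)) (inj₂ (inj₁ i)) == Adj w (inj₂ (inj₁ i))))
    columns-differ₁ k (inj₂ (inj₂ k′)) moved = nearHalf-lower (B-columns-differ k k′ (≢-sym (not-finEq⇒≢ k′ k moved)))
    columns-differ₁ _ (inj₁ _) ()
    columns-differ₁ _ (inj₂ (inj₁ _)) ()

    -- The total defect of a permutation.

    module _ (π : Vtx ℓ ↔ Vtx ℓ) {r : ℕ}
      -- The extractor in counting form: at least a 1 / r fraction of the pairs from two large sets
      -- change value under tampering. `S₁` comes first because the first argument of `E` indexes
      -- V₁.
      (extract : (S₁ S₀ : Fin n → Bool) (f g : Fin n → Fin n) → NoFixedPoint f → NoFixedPoint g →
                 n + 1 ≤ 16 * countFin n S₁ → n + 1 ≤ 16 * countFin n S₀ →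
                 countFin n S₁ * countFin n S₀ ≤
                 r * sumℕ n (λ i → countFin n (λ j → S₁ i ∧ (S₀ j ∧ not (E i j == E (f i) (g j))))))
      where

      private
        p : Vtx ℓ → Vtx ℓ
        p = Inverse.from π

        differs : Vtx ℓ → Vtx ℓ → Bool
        differs v u = not (Adj v u == Adj (p v) (p u))

        defect : Vtx ℓ → ℕ
        defect v = sumVtx ℓ (ind ∘ differs v)

        D = orderedSymDiff G π

        stays changed moves : Vtx ℓ → Bool
        stays v = movedWithin (p v) v
        changed v = changedPart (p v) v
        moves v = not (vtxEq ℓ (p v) v)

        C  = sumVtx ℓ (ind ∘ changed)
        s₀ = countFin n (stays ∘ inj₁)
        s₁ = countFin n (stays ∘ inj₂ ∘ inj₁)
        s₂ = countFin M (stays ∘ inj₂ ∘ inj₂)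
        m₀ = countFin n (moves ∘ inj₁)
        m₁ = countFin n (moves ∘ inj₂ ∘ inj₁)
        m₂ = countFin M (moves ∘ inj₂ ∘ inj₂)
        D₀ = sumℕ n (defect ∘ inj₁)
        D₁ = sumℕ n (defect ∘ inj₂ ∘ inj₁)
        D₂ = sumℕ M (defect ∘ inj₂ ∘ inj₂)

      -- Reindexing the neighbours of `p v` along the bijection `p` makes both degrees comparable
      -- term by term, so they differ by at most the defect.
      degree-image : ∀ v → deg (p v) ≡ sumVtx ℓ (λ u → ind (Adj (p v) (p u)))
      degree-image v = sym (sumVtx-permute (↔-sym π) (ind ∘ Adj (p v)))

      degree≤ : ∀ v → deg v ≤ deg (p v) + defect v
      degree≤ v rewrite degree-image v = ≤-trans
        (sumVtx-mono (λ u → ind-≤ (Adj v u) (Adj (p v) (p u))))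
        (≤-reflexive (sumVtx-+ (λ u → ind (Adj (p v) (p u))) (ind ∘ differs v)))

      degree≥ : ∀ v → deg (p v) ≤ deg v + defect v
      degree≥ v rewrite degree-image v = ≤-trans
        (sumVtx-mono (λ u → ind-≥ (Adj v u) (Adj (p v) (p u))))
        (≤-reflexive (sumVtx-+ (ind ∘ Adj v) (ind ∘ differs v)))

      gap⇒defect : ∀ {a b d} → 10 * Q * a + n ≤ 10 * Q * b → b ≤ a + d → n ≤ 10 * Q * d
      gap⇒defect {a} {b} {d} gap b≤ = +-cancelˡ-≤ (10 * Q * a) _ _
        (≤-trans gap (≤-trans (*-monoʳ-≤ (10 * Q) b≤) (≤-reflexive (*-distribˡ-+ (10 * Q) a d))))

      changed-defect : ∀ v → changed v ≡ true → n ≤ 10 * Q * defect v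
      changed-defect v eq with part-gap v (p v) eq
      ... | inj₁ gap = gap⇒defect {deg v} {deg (p v)} gap (degree≥ v)
      ... | inj₂ gap = gap⇒defect {deg (p v)} {deg v} gap (degree≤ v)

      crossing : C * n ≤ 10 * Q * D
      crossing = countVtx-weight n (10 * Q) changed-defect

      -- A vertex u fixed by π keeps its adjacency to v, so a difference between the rows
      -- of v and p v at u contributes to the defect of v.
      visible : ∀ v u → ind (not (Adj v u == Adj (p v) u)) ≤ ind (moves u) + ind (differs v u)
      visible v u with vtxEq ℓ (p u) u in eq
      ... | true  = ≤-reflexive (cong (λ x → ind (not (Adj v u == Adj (p v) x))) (sym (vtxEq⇒≡ (p u) u eq)))
      ... | false = ≤-trans (ind≤1 _) (m≤m+n 1 _)

      visible-sum : ∀ a (ι : Fin a → Vtx ℓ) v →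
        countFin a (λ i → not (Adj v (ι i) == Adj (p v) (ι i))) ≤ countFin a (moves ∘ ι) + countFin a (differs v ∘ ι)
      visible-sum a ι v = ≤-trans (sumℕ-mono a (visible v ∘ ι)) (≤-reflexive (sumℕ-+ a _ _))

      sum₀≤ : ∀ f → sumℕ n (f ∘ inj₁) ≤ sumVtx ℓ f
      sum₀≤ f = ≤-trans (m≤m+n (sumℕ n (f ∘ inj₁)) (sumℕ n (f ∘ inj₂ ∘ inj₁))) (m≤m+n _ _)

      sum₁≤ : ∀ f → sumℕ n (f ∘ inj₂ ∘ inj₁) ≤ sumVtx ℓ f
      sum₁≤ f = ≤-trans (m≤n+m (sumℕ n (f ∘ inj₂ ∘ inj₁)) (sumℕ n (f ∘ inj₁))) (m≤m+n _ _)

      sum₂≤ : ∀ f → sumℕ M (f ∘ inj₂ ∘ inj₂) ≤ sumVtx ℓ f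
      sum₂≤ f = m≤n+m _ _

      -- In short, 20 e ≥ 20 d ≥ 20 y - 20 m ≥ 9 x - 8 x.
      few-moves : ∀ {x y m d e} → 9 * x ≤ 20 * y → 5 * m ≤ 2 * x → y ≤ m + d → d ≤ e → x ≤ 20 * e
      few-moves {x} {y} {m} {d} {e} x≤y m≤x y≤ d≤e =
        ≤-by 0 (+-mono-≤ (+-mono-≤ x≤y (*-monoʳ-≤ 4 m≤x)) (*-monoʳ-≤ 20 (+-mono-≤ y≤ d≤e)))
          (identity x y m d e)
        where
        identity : ∀ x y m d e → x + (20 * y + 4 * (2 * x) + 20 * (m + d + e) + 0) ≡
                                 20 * e + (9 * x + 4 * (5 * m) + 20 * (y + d))
        identity = solve-∀

      n≤M : n ≤ M
      n≤M = subst (n ≤_) (sym M≡) (≤-trans (m≤n*m n 4) (m≤m+n (4 * n) 3))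

      rows₀ : 5 * m₂ ≤ 2 * M → ∀ i → stays (inj₁ i) ≡ true → n ≤ 20 * defect (inj₁ i)
      rows₀ few i eq = ≤-trans n≤M (few-moves {M} {m = m₂} (rows-differ₀ i (p (inj₁ i)) eq) few
        (visible-sum M (inj₂ ∘ inj₂) (inj₁ i)) (sum₂≤ (ind ∘ differs (inj₁ i))))

      rows₁ : 5 * m₂ ≤ 2 * M → ∀ i → stays (inj₂ (inj₁ i)) ≡ true → n ≤ 20 * defect (inj₂ (inj₁ i))
      rows₁ few i eq = ≤-trans n≤M (few-moves {M} {m = m₂} (rows-differ₁ i (p (inj₂ (inj₁ i))) eq) few
        (visible-sum M (inj₂ ∘ inj₂) (inj₂ (inj₁ i))) (sum₂≤ (ind ∘ differs (inj₂ (inj₁ i)))))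

      rows : 5 * m₂ ≤ 2 * (4 * n + 3) → (s₀ + s₁) * n ≤ 20 * D
      rows few = begin
        (s₀ + s₁) * n           ≡⟨ *-distribʳ-+ n s₀ s₁ ⟩
        s₀ * n + s₁ * n         ≤⟨ +-mono-≤ (countFin-weight n n 20 (rows₀ few′)) (countFin-weight n n 20 (rows₁ few′)) ⟩
        20 * D₀ + 20 * D₁       ≡⟨ *-distribˡ-+ 20 D₀ D₁ ⟨
        20 * (D₀ + D₁)          ≤⟨ *-monoʳ-≤ 20 (m≤m+n (D₀ + D₁) D₂) ⟩
        20 * D                  ∎
        where
        open ≤-Reasoning
        few′ : 5 * m₂ ≤ 2 * M
        few′ = subst (λ x → 5 * m₂ ≤ 2 * x) (sym M≡) few

      columns₀ : 5 * m₀ ≤ 2 * n → s₂ * n ≤ 20 * D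
      columns₀ few = ≤-trans (countFin-weight M n 20 column) (*-monoʳ-≤ 20 (sum₂≤ defect))
        where
        column : ∀ k → stays (inj₂ (inj₂ k)) ≡ true → n ≤ 20 * defect (inj₂ (inj₂ k))
        column k eq = few-moves {n} {m = m₀} (columns-differ₀ k (p (inj₂ (inj₂ k))) eq) few
          (visible-sum n inj₁ (inj₂ (inj₂ k))) (sum₀≤ (ind ∘ differs (inj₂ (inj₂ k))))

      columns₁ : 5 * m₁ ≤ 2 * n → s₂ * n ≤ 20 * D
      columns₁ few = ≤-trans (countFin-weight M n 20 column) (*-monoʳ-≤ 20 (sum₂≤ defect))
        where
        column : ∀ k → stays (inj₂ (inj₂ k)) ≡ true → n ≤ 20 * defect (inj₂ (inj₂ k))
        column k eq = few-moves {n} {m = m₁} (columns-differ₁ k (p (inj₂ (inj₂ k))) eq) few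
          (visible-sum n (inj₂ ∘ inj₁) (inj₂ (inj₂ k))) (sum₁≤ (ind ∘ differs (inj₂ (inj₂ k))))

      -- The pairs found by `extract` have first vertex in V₁ and second in V₀, and form a sub-sum
      -- of `D`.
      blocks : n + 1 ≤ 16 * s₀ → n + 1 ≤ 16 * s₁ → s₀ * s₁ ≤ r * D
      blocks many₀ many₁ = begin
        s₀ * s₁  ≡⟨ *-comm s₀ s₁ ⟩
        s₁ * s₀  ≤⟨ extract S₁ S₀ f g (λ i → proj₁ (proj₂ (f-image i)))
                            (λ j → proj₁ (proj₂ (g-image j))) many₁ many₀ ⟩
        r * sumℕ n (λ i → countFin n (λ j → S₁ i ∧ (S₀ j ∧ not (E i j == E (f i) (g j)))))
                 ≤⟨ *-monoʳ-≤ r (≤-trans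
                     (sumℕ-mono n (λ i → ≤-trans (sumℕ-mono n (pair i)) (sum₀≤ (ind ∘ differs (inj₂ (inj₁ i))))))
                     (sum₁≤ defect)) ⟩
        r * D    ∎
        where
        open ≤-Reasoning
        S₀ S₁ : Fin n → Bool
        S₀ = stays ∘ inj₁
        S₁ = stays ∘ inj₂ ∘ inj₁
        2≤n = ≤-trans (n≤1+n 2) 3≤n
        f-image = λ i → image₁ 2≤n i (p (inj₂ (inj₁ i)))
        g-image = λ j → image₀ 2≤n j (p (inj₁ j))
        f g : Fin n → Fin n
        f i = proj₁ (f-image i)
        g j = proj₁ (g-image j)
        pair : ∀ i j → ind (S₁ i ∧ (S₀ j ∧ not (E i j == E (f i) (g j)))) ≤ ind (differs (inj₂ (inj₁ i)) (inj₁ j))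
        pair i j with S₁ i in eq₁ | S₀ j in eq₀
        ... | false | _     = z≤n
        ... | true  | false = z≤n
        -- On `S₁` and `S₀` the functions `f` and `g` agree with `p`, so the two values of `E` are
        -- the adjacencies before and after applying `p`.
        ... | true  | true  = ≤-reflexive (cong₂ (λ v u → ind (not (E i j == Adj v u)))
          (sym (proj₂ (proj₂ (f-image i)) eq₁)) (sym (proj₂ (proj₂ (g-image j)) eq₀)))

      moves-split : ∀ a (ι : Fin a → Vtx ℓ) → countFin a (moves ∘ ι) ≡
                    countFin a (stays ∘ ι) + countFin a (changed ∘ ι)
      moves-split a ι = trans (sumℕ-cong a (λ i → moved-split (p (ι i)) (ι i))) (sumℕ-+ a _ _)

      s+C≡moves : s₀ + s₁ + s₂ + C ≡ sumVtx ℓ (ind ∘ moves)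
      s+C≡moves = trans (sym (sumVtx-+ (ind ∘ stays) (ind ∘ changed)))
        (sumVtx-cong (λ v → sym (moved-split (p v) v)))

      -- The definition counts vertices moved by `π`, the argument those moved by `p`; the two maps
      -- have the same fixed points.
      moved≡ : moved G π ≡ s₀ + s₁ + s₂ + C
      moved≡ = trans (sumVtx-cong (λ v → cong (ind ∘ not) (vtxEq-⇔ (to⇒from v) (from⇒to v)))) (sym s+C≡moves)
        where
        to⇒from : ∀ v → Inverse.to π v ≡ v → p v ≡ v
        to⇒from v eq = trans (cong p (sym eq)) (Inverse.strictlyInverseʳ π v)
        from⇒to : ∀ v → p v ≡ v → Inverse.to π v ≡ v
        from⇒to v eq = trans (cong (Inverse.to π) (sym eq)) (Inverse.strictlyInverseˡ π v)

      vertices≤ : n + (n + M) ≤ 7 * n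
      vertices≤ = ≤-by 0 (+-mono-≤ (≤-reflexive M≡) 3≤n) (identity n M)
        where
        identity : ∀ n M → n + (n + M) + (4 * n + 3 + n + 0) ≡ 7 * n + (M + 3)
        identity = solve-∀

      moved-defect : moved G π * n ≤ 7 * (256 * (10 * Q + r + 1)) * D
      moved-defect = subst (λ t → t * n ≤ 7 * (256 * (10 * Q + r + 1)) * D) (sym moved≡)
        (Counting.moved-bound {n} {10 * Q} {r} {D} {C} {s₀} {s₁} {s₂} {m₀} {m₁} {m₂}
          (≤-trans (≤-reflexive (moves-split n inj₁)) (+-monoʳ-≤ s₀ (sum₀≤ (ind ∘ changed))))
          (≤-trans (≤-reflexive (moves-split n (inj₂ ∘ inj₁))) (+-monoʳ-≤ s₁ (sum₁≤ (ind ∘ changed))))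
          (≤-trans (≤-reflexive (moves-split M (inj₂ ∘ inj₂))) (+-monoʳ-≤ s₂ (sum₂≤ (ind ∘ changed))))
          (≤-trans (≤-reflexive s+C≡moves) (≤-trans (countVtx≤ moves) vertices≤))
          crossing rows columns₀ columns₁ blocks)

-- Rational arithmetic and the extractor hypothesis.

module Rationals where

  open import Algebra.Bundles using (CommutativeRing)
  open import Data.Bool using (Bool; true; false; not; _∧_)
  open import Data.Fin using (Fin; zero; suc)
  open import Data.Integer as ℤ using () renaming (+_ to pos)
  import Data.Integer.Properties as ℤ
  open import Data.Nat as ℕ using (ℕ; zero; suc)
  import Data.Nat.Properties as ℕ
  open import Data.Product using (_×_; Σ; _,_; proj₁; proj₂)
  open import Data.Rational as ℚ using (ℚ; mkℚ; 0ℚ; 1ℚ; ½; _+_; _*_; _-_; -_; ∣_∣; _≤_; _<_; _/_; toℚᵘ; *≤*; *<*)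
  open import Data.Rational.Properties
  open import Data.Rational.Solver using (module +-*-Solver)
  open import Data.Rational.Unnormalised as ℚᵘ using (mkℚᵘ; *≡*)
  import Data.Rational.Unnormalised.Properties as ℚᵘ
  open import Algebra.Properties.Semiring.Sum (CommutativeRing.semiring +-*-commutativeRing) as ∑ using ()
  open import Data.Sum using (inj₁; inj₂)
  open import Function using (_∘_)
  open import Relation.Binary.PropositionalEquality
    using (_≡_; refl; sym; trans; cong; cong₂; subst; module ≡-Reasoning)

  -- Unnormalised fractions have no gcd to compute, so the homomorphism laws reduce to integer
  -- identities there.
  toℚᵘ-ℕ→ℚ : ∀ n → toℚᵘ (ℕ→ℚ n) ℚᵘ.≃ mkℚᵘ (pos n) 0
  toℚᵘ-ℕ→ℚ n = toℚᵘ-fromℚᵘ (mkℚᵘ (pos n) 0)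

  ℕ→ℚ-+ : ∀ m n → ℕ→ℚ (m ℕ.+ n) ≡ ℕ→ℚ m + ℕ→ℚ n
  ℕ→ℚ-+ m n = toℚᵘ-injective (begin
    toℚᵘ (ℕ→ℚ (m ℕ.+ n))              ≈⟨ toℚᵘ-ℕ→ℚ (m ℕ.+ n) ⟩
    mkℚᵘ (pos (m ℕ.+ n)) 0              ≈⟨ *≡* (cong (ℤ._* pos 1)
                                                (cong₂ ℤ._+_ (sym (ℤ.*-identityʳ (pos m))) (sym (ℤ.*-identityʳ (pos n))))) ⟩
    mkℚᵘ (pos m) 0 ℚᵘ.+ mkℚᵘ (pos n) 0    ≈⟨ ℚᵘ.+-cong (toℚᵘ-ℕ→ℚ m) (toℚᵘ-ℕ→ℚ n) ⟨
    toℚᵘ (ℕ→ℚ m) ℚᵘ.+ toℚᵘ (ℕ→ℚ n)    ≈⟨ toℚᵘ-homo-+ (ℕ→ℚ m) (ℕ→ℚ n) ⟨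
    toℚᵘ (ℕ→ℚ m + ℕ→ℚ n)              ∎)
    where open ℚᵘ.≃-Reasoning

  ℕ→ℚ-* : ∀ m n → ℕ→ℚ (m ℕ.* n) ≡ ℕ→ℚ m * ℕ→ℚ n
  ℕ→ℚ-* m n = toℚᵘ-injective (begin
    toℚᵘ (ℕ→ℚ (m ℕ.* n))              ≈⟨ toℚᵘ-ℕ→ℚ (m ℕ.* n) ⟩
    mkℚᵘ (pos (m ℕ.* n)) 0              ≈⟨ *≡* (cong (ℤ._* pos 1) (ℤ.pos-* m n)) ⟩
    mkℚᵘ (pos m) 0 ℚᵘ.* mkℚᵘ (pos n) 0    ≈⟨ ℚᵘ.*-cong (toℚᵘ-ℕ→ℚ m) (toℚᵘ-ℕ→ℚ n) ⟨
    toℚᵘ (ℕ→ℚ m) ℚᵘ.* toℚᵘ (ℕ→ℚ n)    ≈⟨ toℚᵘ-homo-* (ℕ→ℚ m) (ℕ→ℚ n) ⟨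
    toℚᵘ (ℕ→ℚ m * ℕ→ℚ n)              ∎)
    where open ℚᵘ.≃-Reasoning

  ℕ→ℚ-mono : ∀ {m n} → m ℕ.≤ n → ℕ→ℚ m ≤ ℕ→ℚ n
  ℕ→ℚ-mono {m} {n} m≤n = toℚᵘ-cancel-≤ (ℚᵘ.≤-respˡ-≃ (ℚᵘ.≃-sym (toℚᵘ-ℕ→ℚ m)) (ℚᵘ.≤-respʳ-≃ (ℚᵘ.≃-sym (toℚᵘ-ℕ→ℚ n))
    (ℚᵘ.*≤* (ℤ.*-monoʳ-≤-nonNeg (pos 1) (ℤ.+≤+ m≤n)))))

  ℕ→ℚ-mono-< : ∀ {m n} → m ℕ.< n → ℕ→ℚ m < ℕ→ℚ n
  ℕ→ℚ-mono-< {m} {n} m<n = toℚᵘ-cancel-< (ℚᵘ.<-respˡ-≃ (ℚᵘ.≃-sym (toℚᵘ-ℕ→ℚ m)) (ℚᵘ.<-respʳ-≃ (ℚᵘ.≃-sym (toℚᵘ-ℕ→ℚ n))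
    (ℚᵘ.*<* (ℤ.*-monoʳ-<-pos (pos 1) (ℤ.+<+ m<n)))))

  ℕ→ℚ-cancel : ∀ {m n} → ℕ→ℚ m ≤ ℕ→ℚ n → m ℕ.≤ n
  ℕ→ℚ-cancel {m} {n} m≤n = ℕ.≮⇒≥ (λ n<m → <-irrefl refl (<-≤-trans (ℕ→ℚ-mono-< n<m) m≤n))

  ℕ→ℚ-cancel-< : ∀ {m n} → ℕ→ℚ m < ℕ→ℚ n → m ℕ.< n
  ℕ→ℚ-cancel-< {m} {n} m<n = ℕ.≰⇒> (λ n≤m → <-irrefl refl (<-≤-trans m<n (ℕ→ℚ-mono n≤m)))

  ℕ→ℚ-nonNeg : ∀ n → ℚ.NonNegative (ℕ→ℚ n)
  ℕ→ℚ-nonNeg n = ℚ.nonNegative (ℕ→ℚ-mono {0} {n} ℕ.z≤n)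

  clear-denominator : ∀ p → 0ℚ ≤ p → p * ℕ→ℚ (ℚ.↧ₙ p) ≡ ℕ→ℚ ℤ.∣ ℚ.↥ p ∣
  clear-denominator (mkℚ (pos a) b-1 c) 0≤p = toℚᵘ-injective (begin
    toℚᵘ (mkℚ (pos a) b-1 c * ℕ→ℚ (suc b-1))       ≈⟨ toℚᵘ-homo-* (mkℚ (pos a) b-1 c) (ℕ→ℚ (suc b-1)) ⟩
    mkℚᵘ (pos a) b-1 ℚᵘ.* toℚᵘ (ℕ→ℚ (suc b-1))     ≈⟨ ℚᵘ.*-congˡ {mkℚᵘ (pos a) b-1} (toℚᵘ-ℕ→ℚ (suc b-1)) ⟩
    mkℚᵘ (pos a) b-1 ℚᵘ.* mkℚᵘ (pos (suc b-1)) 0       ≈⟨ *≡* (trans (ℤ.*-identityʳ _)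
                                                                (cong (λ d → pos a ℤ.* pos d) (sym (ℕ.*-identityʳ (suc b-1))))) ⟩
    mkℚᵘ (pos a) 0                                 ≈⟨ toℚᵘ-ℕ→ℚ a ⟨
    toℚᵘ (ℕ→ℚ a)                                 ∎)
    where open ℚᵘ.≃-Reasoning
  clear-denominator (mkℚ ℤ.-[1+ a ] b-1 c) (*≤* ())

  reciprocal : ∀ s → 1 ℕ.≤ s → Σ ℚ λ w → 0ℚ < w × w * ℕ→ℚ s ≡ 1ℚ
  reciprocal s 1≤s = ℚ.1/ ℕ→ℚ s , positive⁻¹ (ℚ.1/ ℕ→ℚ s) , *-inverseˡ (ℕ→ℚ s)
    where
    instance
      s-positive : ℚ.Positive (ℕ→ℚ s)
      s-positive = ℚ.positive (ℕ→ℚ-mono-< 1≤s)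
      s-nonZero : ℚ.NonZero (ℕ→ℚ s)
      s-nonZero = pos⇒nonZero (ℕ→ℚ s)
      1/s-positive : ℚ.Positive (ℚ.1/ ℕ→ℚ s)
      1/s-positive = 1/pos⇒pos (ℕ→ℚ s)

  sumℚ≡sum : ∀ n (f : Fin n → ℚ) → sumℚ n f ≡ ∑.sum f
  sumℚ≡sum zero    f = refl
  sumℚ≡sum (suc n) f = cong (f zero +_) (sumℚ≡sum n (f ∘ suc))

  sumℚ-cong : ∀ n {f g : Fin n → ℚ} → (∀ i → f i ≡ g i) → sumℚ n f ≡ sumℚ n g
  sumℚ-cong zero    f≗g = refl
  sumℚ-cong (suc n) f≗g = cong₂ _+_ (f≗g zero) (sumℚ-cong n (f≗g ∘ suc))

  sumℚ-+ : ∀ n (f g : Fin n → ℚ) → sumℚ n (λ i → f i + g i) ≡ sumℚ n f + sumℚ n g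
  sumℚ-+ n f g = begin
    sumℚ n (λ i → f i + g i)  ≡⟨ sumℚ≡sum n _ ⟩
    ∑.sum (λ i → f i + g i)   ≡⟨ ∑.∑-distrib-+ f g ⟩
    ∑.sum f + ∑.sum g         ≡⟨ cong₂ _+_ (sumℚ≡sum n f) (sumℚ≡sum n g) ⟨
    sumℚ n f + sumℚ n g       ∎
    where open ≡-Reasoning

  sumℚ-*ˡ : ∀ n c (f : Fin n → ℚ) → sumℚ n (λ i → c * f i) ≡ c * sumℚ n f
  sumℚ-*ˡ n c f = begin
    sumℚ n (λ i → c * f i)  ≡⟨ sumℚ≡sum n _ ⟩
    ∑.sum (λ i → c * f i)   ≡⟨ ∑.*-distribˡ-sum c f ⟨
    c * ∑.sum f             ≡⟨ cong (c *_) (sumℚ≡sum n f) ⟨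
    c * sumℚ n f            ∎
    where open ≡-Reasoning

  sumℚ-ℕ : ∀ n (f : Fin n → ℕ) → sumℚ n (ℕ→ℚ ∘ f) ≡ ℕ→ℚ (sumℕ n f)
  sumℚ-ℕ zero    f = refl
  sumℚ-ℕ (suc n) f = trans (cong (ℕ→ℚ (f zero) +_) (sumℚ-ℕ n (f ∘ suc))) (sym (ℕ→ℚ-+ (f zero) _))

  p≤∣p∣ : ∀ p → p ≤ ∣ p ∣
  p≤∣p∣ p with ≤-total 0ℚ p
  ... | inj₁ 0≤p = ≤-reflexive (sym (0≤p⇒∣p∣≡p 0≤p))
  ... | inj₂ p≤0 = ≤-trans p≤0 (0≤∣p∣ p)

  -p≤∣p∣ : ∀ p → - p ≤ ∣ p ∣
  -p≤∣p∣ p = subst (- p ≤_) (∣-p∣≡∣p∣ p) (p≤∣p∣ (- p))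

  -- Expectations over independent sources.

  module _ {N k : ℕ} (X Y : Source N k) where

    expectation : (Fin N → Fin N → ℚ) → ℚ
    expectation h = sumℚ N (λ x → sumℚ N (λ y → pr X x * pr Y y * h x y))

    expectation-cong : ∀ {h h′} → (∀ x y → h x y ≡ h′ x y) → expectation h ≡ expectation h′
    expectation-cong h≗h′ = sumℚ-cong N (λ x → sumℚ-cong N (λ y → cong (pr X x * pr Y y *_) (h≗h′ x y)))

    expectation-+ : ∀ h h′ → expectation (λ x y → h x y + h′ x y) ≡ expectation h + expectation h′
    expectation-+ h h′ = trans
      (sumℚ-cong N (λ x → trans (sumℚ-cong N (λ y → *-distribˡ-+ (pr X x * pr Y y) (h x y) (h′ x y))) (sumℚ-+ N _ _)))
      (sumℚ-+ N _ _)

    expectation-1 : expectation (λ _ _ → 1ℚ) ≡ 1ℚ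
    expectation-1 = trans (sumℚ-cong N row) (total X)
      where
      row : ∀ x → sumℚ N (λ y → pr X x * pr Y y * 1ℚ) ≡ pr X x
      row x = begin
        sumℚ N (λ y → pr X x * pr Y y * 1ℚ)  ≡⟨ sumℚ-cong N (λ y → *-identityʳ (pr X x * pr Y y)) ⟩
        sumℚ N (λ y → pr X x * pr Y y)       ≡⟨ sumℚ-*ˡ N (pr X x) (pr Y) ⟩
        pr X x * sumℚ N (pr Y)               ≡⟨ cong (pr X x *_) (total Y) ⟩
        pr X x * 1ℚ                          ≡⟨ *-identityʳ (pr X x) ⟩
        pr X x                               ∎
        where open ≡-Reasoning

    disagreement : (Fin N → Fin N → Bool) → (f g : Fin N → Fin N) → ℚ
    disagreement E f g = expectation (λ x y → indℚ (not (E x y == E (f x) (g y))))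

    -- In the sum with signs + on the diagonal and - off it, the tampered marginals cancel.
    disagreement-bound : ∀ {ε E} → NonMalleableExtractor N k ε E →
      ∀ f g → NoFixedPoint f → NoFixedPoint g → ½ - ε ≤ disagreement E f g
    disagreement-bound {ε} {E} extractor f g f-free g-free = begin
      ½ - ε             ≤⟨ +-monoʳ-≤ ½ (neg-antimono-≤ signed≤ε) ⟩
      ½ - (½ - Δ)       ≡⟨ involution Δ ⟩
      Δ                 ∎
      where
      open ≤-Reasoning
      open +-*-Solver
      involution : ∀ d → ½ - (½ - d) ≡ d
      involution = solve 1 (λ d → con ½ :- (con ½ :- d) := d) refl
      double : ∀ d → ½ - d ≡ ½ * (1ℚ - d - d)
      double = solve 1 (λ d → con ½ :- d := con ½ :* (con 1ℚ :- d :- d)) refl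
      cancel : ∀ a b c d e t u → ½ * (a + d + e - e - (b + c)) ≡
               ½ * ((a - ½ * t) + - (b - ½ * u) + (- (c - ½ * t) + (d - ½ * u)))
      cancel = solve 7 (λ a b c d e t u → con ½ :* (a :+ d :+ e :- e :- (b :+ c)) :=
        con ½ :* ((a :- con ½ :* t) :+ :- (b :- con ½ :* u) :+ (:- (c :- con ½ :* t) :+ (d :- con ½ :* u)))) refl
      Δ = disagreement E f g
      J = jointPr E X Y f g
      T = tamperedPr E X Y f g
      J-diagonal : J false false + J true true + Δ ≡ 1ℚ
      J-diagonal = trans (cong (_+ Δ) (sym (expectation-+ _ _))) (trans (sym (expectation-+ _ _))
        (trans (expectation-cong (λ x y → cases (E x y) (E (f x) (g y)))) expectation-1))
        where
        cases : ∀ a b → indℚ ((a == false) ∧ (b == false)) + indℚ ((a == true) ∧ (b == true)) + indℚ (not (a == b)) ≡ 1ℚ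
        cases true  true  = refl
        cases true  false = refl
        cases false true  = refl
        cases false false = refl
      J-off-diagonal : J false true + J true false ≡ Δ
      J-off-diagonal = trans (sym (expectation-+ _ _)) (expectation-cong (λ x y → cases (E x y) (E (f x) (g y))))
        where
        cases : ∀ a b → indℚ ((a == false) ∧ (b == true)) + indℚ ((a == true) ∧ (b == false)) ≡ indℚ (not (a == b))
        cases true  true  = refl
        cases true  false = refl
        cases false true  = refl
        cases false false = refl
      signed≤ε : ½ - Δ ≤ ε
      signed≤ε = begin
        ½ - Δ
          ≡⟨ double Δ ⟩
        ½ * (1ℚ - Δ - Δ)
          ≡⟨ cong₂ (λ a b → ½ * (a - Δ - b)) J-diagonal J-off-diagonal ⟨
        ½ * (J false false + J true true + Δ - Δ - (J false true + J true false))
          ≡⟨ cancel (J false false) (J false true) (J true false) (J true true) Δ (T false) (T true) ⟩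
        ½ * ((J false false - ½ * T false) + - (J false true - ½ * T true) +
             (- (J true false - ½ * T false) + (J true true - ½ * T true)))
          ≤⟨ *-monoˡ-≤-nonNeg ½ (+-mono-≤
             (+-mono-≤ (p≤∣p∣ (J false false - ½ * T false)) (-p≤∣p∣ (J false true - ½ * T true)))
             (+-mono-≤ (-p≤∣p∣ (J true false - ½ * T false)) (p≤∣p∣ (J true true - ½ * T true)))) ⟩
        ½ * sum₂ (λ α → sum₂ (λ β → ∣ J α β - ½ * T β ∣))
          ≤⟨ extractor X Y f g f-free g-free ⟩
        ε ∎

  0≤indℚ : ∀ b → 0ℚ ≤ indℚ b
  0≤indℚ b = nonNegative⁻¹ (indℚ b) {{ℕ→ℚ-nonNeg (ind b)}}

  module _ {N : ℕ} where

    -- The uniform distribution on `S`, with `w` = 1 / |S|: the bound 2 ^ k ≤ |S| makes `S` nonempty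
    -- and gives the min-entropy.
    flat : ∀ k (S : Fin N → Bool) → 2 ℕ.^ k ℕ.≤ countFin N S →
           Σ ℚ λ w → w * ℕ→ℚ (countFin N S) ≡ 1ℚ × Σ (Source N k) λ X → ∀ i → pr X i ≡ w * indℚ (S i)
    flat k S 2^k≤s = w , ws≡1 , X , λ _ → refl
      where
      inverse = reciprocal (countFin N S) (ℕ.≤-trans (ℕ.m^n>0 2 k) 2^k≤s)
      w = proj₁ inverse
      0<w = proj₁ (proj₂ inverse)
      ws≡1 = proj₂ (proj₂ inverse)
      instance
        w-nonNeg : ℚ.NonNegative w
        w-nonNeg = ℚ.nonNegative (<⇒≤ 0<w)
      entropy : ∀ b → w * indℚ b * ℕ→ℚ (2 ℕ.^ k) ≤ 1ℚ
      entropy true = begin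
        w * 1ℚ * ℕ→ℚ (2 ℕ.^ k)      ≡⟨ cong (_* ℕ→ℚ (2 ℕ.^ k)) (*-identityʳ w) ⟩
        w * ℕ→ℚ (2 ℕ.^ k)           ≤⟨ *-monoˡ-≤-nonNeg w (ℕ→ℚ-mono 2^k≤s) ⟩
        w * ℕ→ℚ (countFin N S)      ≡⟨ ws≡1 ⟩
        1ℚ                          ∎
        where open ≤-Reasoning
      entropy false = begin
        w * 0ℚ * ℕ→ℚ (2 ℕ.^ k)      ≡⟨ cong (_* ℕ→ℚ (2 ℕ.^ k)) (*-zeroʳ w) ⟩
        0ℚ * ℕ→ℚ (2 ℕ.^ k)          ≡⟨ *-zeroˡ (ℕ→ℚ (2 ℕ.^ k)) ⟩
        0ℚ                          ≤⟨ nonNegative⁻¹ 1ℚ ⟩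
        1ℚ                          ∎
        where open ≤-Reasoning
      X : Source N k
      X = record
        { pr      = λ i → w * indℚ (S i)
        ; nonneg  = λ i → subst (_≤ w * indℚ (S i)) (*-zeroʳ w) (*-monoˡ-≤-nonNeg w (0≤indℚ (S i)))
        ; total   = trans (sumℚ-*ˡ N w (indℚ ∘ S)) (trans (cong (w *_) (sumℚ-ℕ N (ind ∘ S))) ws≡1)
        ; minEntr = λ i → entropy (S i)
        }

    -- For uniform sources on `S` and `T` the disagreement probability is the number of changed
    -- pairs over |S| |T|; multiplying `disagreement-bound` by |S| |T| turns it into a count.
    flat-disagreement : ∀ {k ε E} → NonMalleableExtractor N k ε E → ∀ f g → NoFixedPoint f → NoFixedPoint g →
      ∀ S T → 2 ℕ.^ k ℕ.≤ countFin N S → 2 ℕ.^ k ℕ.≤ countFin N T →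
      (½ - ε) * ℕ→ℚ (countFin N S ℕ.* countFin N T) ≤
      ℕ→ℚ (sumℕ N (λ i → countFin N (λ j → S i ∧ (T j ∧ not (E i j == E (f i) (g j))))))
    flat-disagreement {k} {ε} {E} extractor f g f-free g-free S T S-large T-large =
      from-flat (flat k S S-large) (flat k T T-large)
      where
      open ≤-Reasoning
      open +-*-Solver
      s = countFin N S
      t = countFin N T
      hit : Fin N → Fin N → Bool
      hit i j = S i ∧ (T j ∧ not (E i j == E (f i) (g j)))
      c = sumℕ N (λ i → countFin N (hit i))
      Flat : (Fin N → Bool) → Set
      Flat R = Σ ℚ λ w → w * ℕ→ℚ (countFin N R) ≡ 1ℚ × Σ (Source N k) λ X → ∀ i → pr X i ≡ w * indℚ (R i)
      regroup : ∀ a b c s t → a * b * c * (s * t) ≡ a * s * (b * t) * c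
      regroup = solve 5 (λ a b c s t → a :* b :* c :* (s :* t) := a :* s :* (b :* t) :* c) refl
      true-true : ∀ w w′ d → w * 1ℚ * (w′ * 1ℚ) * d ≡ w * w′ * d
      true-true = solve 3 (λ w w′ d → w :* con 1ℚ :* (w′ :* con 1ℚ) :* d := w :* w′ :* d) refl
      true-false : ∀ w w′ d → w * 1ℚ * (w′ * 0ℚ) * d ≡ w * w′ * 0ℚ
      true-false = solve 3 (λ w w′ d → w :* con 1ℚ :* (w′ :* con 0ℚ) :* d := w :* w′ :* con 0ℚ) refl
      false-any : ∀ w w′ b d → w * 0ℚ * (w′ * b) * d ≡ w * w′ * 0ℚ
      false-any = solve 4 (λ w w′ b d → w :* con 0ℚ :* (w′ :* b) :* d := w :* w′ :* con 0ℚ) refl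
      conjunction : ∀ w w′ a b d → w * indℚ a * (w′ * indℚ b) * indℚ d ≡ w * w′ * indℚ (a ∧ (b ∧ d))
      conjunction w w′ true  true  d = true-true w w′ (indℚ d)
      conjunction w w′ true  false d = true-false w w′ (indℚ d)
      conjunction w w′ false b     d = false-any w w′ (indℚ b) (indℚ d)
      from-flat : Flat S → Flat T → (½ - ε) * ℕ→ℚ (s ℕ.* t) ≤ ℕ→ℚ c
      from-flat (w , ws≡1 , X , X-flat) (w′ , w′t≡1 , Y , Y-flat) = begin
        (½ - ε) * ℕ→ℚ (s ℕ.* t)
          ≤⟨ *-monoʳ-≤-nonNeg (ℕ→ℚ (s ℕ.* t)) {{ℕ→ℚ-nonNeg (s ℕ.* t)}}
               (disagreement-bound X Y {ε} {E} extractor f g f-free g-free) ⟩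
        disagreement X Y E f g * ℕ→ℚ (s ℕ.* t)
          ≡⟨ cong₂ _*_ disagreement≡ (ℕ→ℚ-* s t) ⟩
        w * w′ * ℕ→ℚ c * (ℕ→ℚ s * ℕ→ℚ t)
          ≡⟨ regroup w w′ (ℕ→ℚ c) (ℕ→ℚ s) (ℕ→ℚ t) ⟩
        w * ℕ→ℚ s * (w′ * ℕ→ℚ t) * ℕ→ℚ c
          ≡⟨ cong₂ (λ a b → a * b * ℕ→ℚ c) ws≡1 w′t≡1 ⟩
        1ℚ * 1ℚ * ℕ→ℚ c
          ≡⟨ *-identityˡ (ℕ→ℚ c) ⟩
        ℕ→ℚ c ∎
        where
        row : ∀ i → sumℚ N (λ j → pr X i * pr Y j * indℚ (not (E i j == E (f i) (g j)))) ≡ w * w′ * ℕ→ℚ (countFin N (hit i))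
        row i = begin-equality
          sumℚ N (λ j → pr X i * pr Y j * indℚ (not (E i j == E (f i) (g j))))
            ≡⟨ sumℚ-cong N (λ j → cong₂ (λ a b → a * b * indℚ (not (E i j == E (f i) (g j)))) (X-flat i) (Y-flat j)) ⟩
          sumℚ N (λ j → w * indℚ (S i) * (w′ * indℚ (T j)) * indℚ (not (E i j == E (f i) (g j))))
            ≡⟨ sumℚ-cong N (λ j → conjunction w w′ (S i) (T j) (not (E i j == E (f i) (g j)))) ⟩
          sumℚ N (λ j → w * w′ * indℚ (hit i j))
            ≡⟨ sumℚ-*ˡ N (w * w′) (λ j → indℚ (hit i j)) ⟩
          w * w′ * sumℚ N (λ j → indℚ (hit i j))
            ≡⟨ cong (λ z → w * w′ * z) (sumℚ-ℕ N (λ j → ind (hit i j))) ⟩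
          w * w′ * ℕ→ℚ (countFin N (hit i)) ∎
        disagreement≡ : disagreement X Y E f g ≡ w * w′ * ℕ→ℚ c
        disagreement≡ = begin-equality
          disagreement X Y E f g
            ≡⟨ sumℚ-cong N row ⟩
          sumℚ N (λ i → w * w′ * ℕ→ℚ (countFin N (hit i)))
            ≡⟨ sumℚ-*ˡ N (w * w′) (λ i → ℕ→ℚ (countFin N (hit i))) ⟩
          w * w′ * sumℚ N (λ i → ℕ→ℚ (countFin N (hit i)))
            ≡⟨ cong (λ z → w * w′ * z) (sumℚ-ℕ N (λ i → countFin N (hit i))) ⟩
          w * w′ * ℕ→ℚ c ∎

  -- Transfer between rational and natural inequalities.

  numerator denominator : ℚ → ℕ
  numerator p = ℤ.∣ ℚ.↥ p ∣
  denominator = ℚ.↧ₙ_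

  1≤numerator : ∀ p → 0ℚ < p → 1 ℕ.≤ numerator p
  1≤numerator (mkℚ (pos zero)    _ _) (*<* (ℤ.+<+ ()))
  1≤numerator (mkℚ (pos (suc a)) _ _) _ = ℕ.s≤s ℕ.z≤n
  1≤numerator (mkℚ ℤ.-[1+ a ]    _ _) (*<* ())

  scale-≤ : ∀ n {p q} → p ≤ q → ℕ→ℚ n * p ≤ ℕ→ℚ n * q
  scale-≤ n = *-monoˡ-≤-nonNeg (ℕ→ℚ n) {{ℕ→ℚ-nonNeg n}}

  -- The numerator of a positive p is at least 1, so 1 / p is at most its denominator; this supplies
  -- the integer constant `r`.
  ≤-denominator : ∀ p → 0ℚ < p → ∀ a b → p * ℕ→ℚ a ≤ ℕ→ℚ b → a ℕ.≤ denominator p ℕ.* b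
  ≤-denominator p 0<p a b pa≤b = ℕ.≤-trans (ℕ.m≤n*m a (numerator p) {{ℕ.>-nonZero (1≤numerator p 0<p)}}) (ℕ→ℚ-cancel (begin
    ℕ→ℚ (numerator p ℕ.* a)       ≡⟨ ℕ→ℚ-* (numerator p) a ⟩
    ℕ→ℚ (numerator p) * ℕ→ℚ a     ≡⟨ cong (λ z → z * ℕ→ℚ a) (clear-denominator p (<⇒≤ 0<p)) ⟨
    p * ℕ→ℚ Q * ℕ→ℚ a             ≡⟨ solve 3 (λ p q a → p :* q :* a := q :* (p :* a)) refl p (ℕ→ℚ Q) (ℕ→ℚ a) ⟩
    ℕ→ℚ Q * (p * ℕ→ℚ a)           ≤⟨ scale-≤ Q pa≤b ⟩
    ℕ→ℚ Q * ℕ→ℚ b                 ≡⟨ ℕ→ℚ-* Q b ⟨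
    ℕ→ℚ (Q ℕ.* b)                 ∎))
    where
    open ≤-Reasoning
    open +-*-Solver
    Q = denominator p

  tenth-≤ : ∀ a x y → a ℕ.* x ℕ.≤ 10 ℕ.* y → (pos 1 / 10) * ℕ→ℚ a * ℕ→ℚ x ≤ ℕ→ℚ y
  tenth-≤ a x y ax≤ = begin
    (pos 1 / 10) * ℕ→ℚ a * ℕ→ℚ x      ≡⟨ *-assoc (pos 1 / 10) (ℕ→ℚ a) (ℕ→ℚ x) ⟩
    (pos 1 / 10) * (ℕ→ℚ a * ℕ→ℚ x)    ≡⟨ cong (λ z → (pos 1 / 10) * z) (ℕ→ℚ-* a x) ⟨
    (pos 1 / 10) * ℕ→ℚ (a ℕ.* x)      ≤⟨ *-monoˡ-≤-nonNeg (pos 1 / 10) (ℕ→ℚ-mono ax≤) ⟩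
    (pos 1 / 10) * ℕ→ℚ (10 ℕ.* y)     ≡⟨ cong (λ z → (pos 1 / 10) * z) (ℕ→ℚ-* 10 y) ⟩
    (pos 1 / 10) * (ℕ→ℚ 10 * ℕ→ℚ y)   ≡⟨ solve 1 (λ y → con (pos 1 / 10) :* (con (ℕ→ℚ 10) :* y) := y) refl (ℕ→ℚ y) ⟩
    ℕ→ℚ y                             ∎
    where
    open ≤-Reasoning
    open +-*-Solver

  ≤-tenth : ∀ a x y → 10 ℕ.* y ℕ.≤ a ℕ.* x → ℕ→ℚ y ≤ (pos 1 / 10) * ℕ→ℚ a * ℕ→ℚ x
  ≤-tenth a x y ≤ax = begin
    ℕ→ℚ y                             ≡⟨ solve 1 (λ y → y := con (pos 1 / 10) :* (con (ℕ→ℚ 10) :* y)) refl (ℕ→ℚ y) ⟩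
    (pos 1 / 10) * (ℕ→ℚ 10 * ℕ→ℚ y)   ≡⟨ cong (λ z → (pos 1 / 10) * z) (ℕ→ℚ-* 10 y) ⟨
    (pos 1 / 10) * ℕ→ℚ (10 ℕ.* y)     ≤⟨ *-monoˡ-≤-nonNeg (pos 1 / 10) (ℕ→ℚ-mono ≤ax) ⟩
    (pos 1 / 10) * ℕ→ℚ (a ℕ.* x)      ≡⟨ cong (λ z → (pos 1 / 10) * z) (ℕ→ℚ-* a x) ⟩
    (pos 1 / 10) * (ℕ→ℚ a * ℕ→ℚ x)    ≡⟨ *-assoc (pos 1 / 10) (ℕ→ℚ a) (ℕ→ℚ x) ⟨
    (pos 1 / 10) * ℕ→ℚ a * ℕ→ℚ x      ∎
    where
    open ≤-Reasoning
    open +-*-Solver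

  module _ (e : ℚ) (0<e : 0ℚ < e) where
    private
      P = numerator e
      Q = denominator e
      eQ≡P : e * ℕ→ℚ Q ≡ ℕ→ℚ P
      eQ≡P = clear-denominator e (<⇒≤ 0<e)

    double-numerator : e < ½ → 2 ℕ.* P ℕ.≤ Q
    double-numerator e<½ = ℕ→ℚ-cancel (begin
      ℕ→ℚ (2 ℕ.* P)             ≡⟨ trans (ℕ→ℚ-* 2 P) (cong (λ z → ℕ→ℚ 2 * z) (sym eQ≡P)) ⟩
      ℕ→ℚ 2 * (e * ℕ→ℚ Q)       ≤⟨ scale-≤ 2 (*-monoʳ-≤-nonNeg (ℕ→ℚ Q) {{ℕ→ℚ-nonNeg Q}} (<⇒≤ e<½)) ⟩
      ℕ→ℚ 2 * (½ * ℕ→ℚ Q)       ≡⟨ solve 1 (λ q → con (ℕ→ℚ 2) :* (con ½ :* q) := q) refl (ℕ→ℚ Q) ⟩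
      ℕ→ℚ Q                     ∎)
      where
      open ≤-Reasoning
      open +-*-Solver

    clear-< : ∀ m x → e * ℕ→ℚ m < ℕ→ℚ x → P ℕ.* m ℕ.< Q ℕ.* x
    clear-< m x em<x = ℕ→ℚ-cancel-< (begin-strict
      ℕ→ℚ (P ℕ.* m)             ≡⟨ trans (ℕ→ℚ-* P m) (cong (λ z → z * ℕ→ℚ m) (sym eQ≡P)) ⟩
      e * ℕ→ℚ Q * ℕ→ℚ m         ≡⟨ solve 3 (λ e q m → e :* q :* m := q :* (e :* m)) refl e (ℕ→ℚ Q) (ℕ→ℚ m) ⟩
      ℕ→ℚ Q * (e * ℕ→ℚ m)       <⟨ *-monoʳ-<-pos (ℕ→ℚ Q) {{ℚ.positive (ℕ→ℚ-mono-< {0} {Q} (ℕ.s≤s ℕ.z≤n))}} em<x ⟩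
      ℕ→ℚ Q * ℕ→ℚ x             ≡⟨ ℕ→ℚ-* Q x ⟨
      ℕ→ℚ (Q ℕ.* x)             ∎)
      where
      open ≤-Reasoning
      open +-*-Solver

    module _ {m x : ℕ} (near : within ½ ((pos 1 / 10) * e) m x) where
      private
        cast : ∀ a b c → ℕ→ℚ (a ℕ.* b ℕ.* c) ≡ ℕ→ℚ a * ℕ→ℚ b * ℕ→ℚ c
        cast a b c = trans (ℕ→ℚ-* (a ℕ.* b) c) (cong (λ z → z * ℕ→ℚ c) (ℕ→ℚ-* a b))
        cast-Pm : ℕ→ℚ (P ℕ.* m) ≡ e * ℕ→ℚ Q * ℕ→ℚ m
        cast-Pm = trans (ℕ→ℚ-* P m) (cong (λ z → z * ℕ→ℚ m) (sym eQ≡P))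
        -- The free `δ` lets the deviation and its negative both be inserted, giving the upper and
        -- the lower bound.
        multiply : ∀ {δ} → δ ≤ ∣ ℕ→ℚ x - ½ * ℕ→ℚ m ∣ → ℕ→ℚ 10 * ℕ→ℚ Q * δ ≤ e * ℕ→ℚ Q * ℕ→ℚ m
        multiply {δ} δ≤ = begin
          ℕ→ℚ 10 * ℕ→ℚ Q * δ                                 ≡⟨ *-assoc (ℕ→ℚ 10) (ℕ→ℚ Q) δ ⟩
          ℕ→ℚ 10 * (ℕ→ℚ Q * δ)                               ≤⟨ scale-≤ 10 (scale-≤ Q (≤-trans δ≤ near)) ⟩
          ℕ→ℚ 10 * (ℕ→ℚ Q * ((pos 1 / 10) * e * ℕ→ℚ m))      ≡⟨ collect (ℕ→ℚ Q) e (ℕ→ℚ m) ⟩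
          e * ℕ→ℚ Q * ℕ→ℚ m                                  ∎
          where
          open ≤-Reasoning
          open +-*-Solver
          collect : ∀ q e m → ℕ→ℚ 10 * (q * ((pos 1 / 10) * e * m)) ≡ e * q * m
          collect = solve 3 (λ q e m → con (ℕ→ℚ 10) :* (q :* (con (pos 1 / 10) :* e :* m)) := e :* q :* m) refl

      within-upper : 10 ℕ.* Q ℕ.* x ℕ.≤ 5 ℕ.* Q ℕ.* m ℕ.+ P ℕ.* m
      within-upper = ℕ→ℚ-cancel (begin
        ℕ→ℚ (10 ℕ.* Q ℕ.* x)
          ≡⟨ cast 10 Q x ⟩
        ℕ→ℚ 10 * ℕ→ℚ Q * ℕ→ℚ x
          ≡⟨ split (ℕ→ℚ Q) (ℕ→ℚ x) (ℕ→ℚ m) ⟩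
        ℕ→ℚ 5 * ℕ→ℚ Q * ℕ→ℚ m + ℕ→ℚ 10 * ℕ→ℚ Q * (ℕ→ℚ x - ½ * ℕ→ℚ m)
          ≤⟨ +-monoʳ-≤ (ℕ→ℚ 5 * ℕ→ℚ Q * ℕ→ℚ m) (multiply (p≤∣p∣ (ℕ→ℚ x - ½ * ℕ→ℚ m))) ⟩
        ℕ→ℚ 5 * ℕ→ℚ Q * ℕ→ℚ m + e * ℕ→ℚ Q * ℕ→ℚ m
          ≡⟨ cong₂ _+_ (cast 5 Q m) cast-Pm ⟨
        ℕ→ℚ (5 ℕ.* Q ℕ.* m) + ℕ→ℚ (P ℕ.* m)
          ≡⟨ ℕ→ℚ-+ (5 ℕ.* Q ℕ.* m) (P ℕ.* m) ⟨
        ℕ→ℚ (5 ℕ.* Q ℕ.* m ℕ.+ P ℕ.* m) ∎)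
        where
        open ≤-Reasoning
        open +-*-Solver
        split : ∀ q x m → ℕ→ℚ 10 * q * x ≡ ℕ→ℚ 5 * q * m + ℕ→ℚ 10 * q * (x - ½ * m)
        split = solve 3 (λ q x m → con (ℕ→ℚ 10) :* q :* x :=
          con (ℕ→ℚ 5) :* q :* m :+ con (ℕ→ℚ 10) :* q :* (x :- con ½ :* m)) refl

      within-lower : 5 ℕ.* Q ℕ.* m ℕ.≤ 10 ℕ.* Q ℕ.* x ℕ.+ P ℕ.* m
      within-lower = ℕ→ℚ-cancel (begin
        ℕ→ℚ (5 ℕ.* Q ℕ.* m)
          ≡⟨ cast 5 Q m ⟩
        ℕ→ℚ 5 * ℕ→ℚ Q * ℕ→ℚ m
          ≡⟨ split (ℕ→ℚ Q) (ℕ→ℚ x) (ℕ→ℚ m) ⟩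
        ℕ→ℚ 10 * ℕ→ℚ Q * ℕ→ℚ x + ℕ→ℚ 10 * ℕ→ℚ Q * (- (ℕ→ℚ x - ½ * ℕ→ℚ m))
          ≤⟨ +-monoʳ-≤ (ℕ→ℚ 10 * ℕ→ℚ Q * ℕ→ℚ x) (multiply (-p≤∣p∣ (ℕ→ℚ x - ½ * ℕ→ℚ m))) ⟩
        ℕ→ℚ 10 * ℕ→ℚ Q * ℕ→ℚ x + e * ℕ→ℚ Q * ℕ→ℚ m
          ≡⟨ cong₂ _+_ (cast 10 Q x) cast-Pm ⟨
        ℕ→ℚ (10 ℕ.* Q ℕ.* x) + ℕ→ℚ (P ℕ.* m)
          ≡⟨ ℕ→ℚ-+ (10 ℕ.* Q ℕ.* x) (P ℕ.* m) ⟨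
        ℕ→ℚ (10 ℕ.* Q ℕ.* x ℕ.+ P ℕ.* m) ∎)
        where
        open ≤-Reasoning
        open +-*-Solver
        split : ∀ q x m → ℕ→ℚ 5 * q * m ≡ ℕ→ℚ 10 * q * x + ℕ→ℚ 10 * q * (- (x - ½ * m))
        split = solve 3 (λ q x m → con (ℕ→ℚ 5) :* q :* m :=
          con (ℕ→ℚ 10) :* q :* x :+ con (ℕ→ℚ 10) :* q :* (:- (x :- con ½ :* m))) refl

  -- The constant is 1 / (2 K); the half matches the ½ in the definition of robustness, where each
  -- edge is counted as two ordered pairs.
  half-reciprocal : ∀ K → 1 ℕ.≤ K → Σ ℚ λ c → 0ℚ < c ×
    (∀ size t D → size ℕ.* t ℕ.≤ K ℕ.* D → c * ℕ→ℚ size * ℕ→ℚ t ≤ ½ * ℕ→ℚ D)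
  half-reciprocal K 1≤K = ½ * w , positive⁻¹ (½ * w) , bound
    where
    inverse = reciprocal K 1≤K
    w = proj₁ inverse
    0<w = proj₁ (proj₂ inverse)
    wK≡1 = proj₂ (proj₂ inverse)
    instance
      w-positive : ℚ.Positive w
      w-positive = ℚ.positive 0<w
      ½w-positive : ℚ.Positive (½ * w)
      ½w-positive = pos*pos⇒pos ½ w
      ½w-nonNeg : ℚ.NonNegative (½ * w)
      ½w-nonNeg = pos⇒nonNeg (½ * w)
    bound : ∀ size t D → size ℕ.* t ℕ.≤ K ℕ.* D → ½ * w * ℕ→ℚ size * ℕ→ℚ t ≤ ½ * ℕ→ℚ D
    bound size t D st≤KD = begin
      ½ * w * ℕ→ℚ size * ℕ→ℚ t      ≡⟨ trans (*-assoc (½ * w) (ℕ→ℚ size) (ℕ→ℚ t))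
                                                (cong (λ z → ½ * w * z) (sym (ℕ→ℚ-* size t))) ⟩
      ½ * w * ℕ→ℚ (size ℕ.* t)      ≤⟨ *-monoˡ-≤-nonNeg (½ * w) (ℕ→ℚ-mono st≤KD) ⟩
      ½ * w * ℕ→ℚ (K ℕ.* D)         ≡⟨ cong (λ z → ½ * w * z) (ℕ→ℚ-* K D) ⟩
      ½ * w * (ℕ→ℚ K * ℕ→ℚ D)       ≡⟨ regroup ½ w (ℕ→ℚ K) (ℕ→ℚ D) ⟩
      ½ * (w * ℕ→ℚ K * ℕ→ℚ D)       ≡⟨ cong (λ z → ½ * (z * ℕ→ℚ D)) wK≡1 ⟩
      ½ * (1ℚ * ℕ→ℚ D)              ≡⟨ cong (λ z → ½ * z) (*-identityˡ (ℕ→ℚ D)) ⟩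
      ½ * ℕ→ℚ D                     ∎
      where
      open ≤-Reasoning
      open +-*-Solver
      regroup : ∀ h w k d → h * w * (k * d) ≡ h * (w * k * d)
      regroup = solve 4 (λ h w k d → h :* w :* (k :* d) := h :* (w :* k :* d)) refl

-- Choice of the constant and transfer to the rational statement.

open import Data.Nat using (ℕ; _^_; _∸_; _≤_)
open import Data.Nat as ℕ using ()
open import Data.Fin using (Fin)
open import Data.Bool using (Bool)
open import Data.Product using (_×_; Σ)
open import Data.Rational using (ℚ; 0ℚ; ½; _*_; _<_; _/_)
open import Data.Rational as ℚ using ()
open import Data.Integer using (+_)

import Data.Nat.Properties as ℕ
open import Data.Product using (_,_; proj₁; proj₂)
open import Data.Sum using (inj₁; inj₂)
open import Data.Rational.Properties using (+-monoʳ-<; neg-antimono-<; +-inverseʳ)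
open import Relation.Binary.PropositionalEquality using (sym; subst)
open Combinatorics
open Rationals

theorem8p7 : (ε ε′ : ℚ) → 0ℚ ℚ.< ε → ε ℚ.< ½ → 0ℚ ℚ.< ε′ → ε′ ℚ.< ½ →
    Σ ℚ (λ c → (0ℚ ℚ.< c) ×
    ((ℓ k : ℕ) → k ℕ.+ 4 ≤ ℓ →
    (nmE : Fin (2 ^ ℓ ∸ 1) → Fin (2 ^ ℓ ∸ 1) → Bool) →
    (B : Fin (2 ^ ℓ ∸ 1) → Fin (2 ^ (ℓ ℕ.+ 2) ∸ 1) → Bool) →
    NonMalleableExtractor (2 ^ ℓ ∸ 1) k ε nmE →
    (∀ x → ε′ * ℕ→ℚ (2 ^ ℓ) ℚ.< ℕ→ℚ (countFin (2 ^ ℓ ∸ 1) (nmE x))) →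
    QuasiOrthogonal (2 ^ ℓ ∸ 1) (2 ^ (ℓ ℕ.+ 2) ∸ 1) ((+ 1 / 10) * ε′) B →
    RobustlySelfOrdered (graphG ℓ nmE B) (c * ℕ→ℚ (FinGraph.size (graphG ℓ nmE B))) ×
    (∀ v → ((+ 3 / 10) * ℕ→ℚ (FinGraph.size (graphG ℓ nmE B))
    ℚ.≤ ℕ→ℚ (degree (graphG ℓ nmE B) v)) ×
    (ℕ→ℚ (degree (graphG ℓ nmE B) v)
    ℚ.≤ (+ 9 / 10) * ℕ→ℚ (FinGraph.size (graphG ℓ nmE B))))))
theorem8p7 ε ε′ 0<ε ε<½ 0<ε′ ε′<½ = proj₁ constant , proj₁ (proj₂ constant) , main
  where
  P = numerator ε′
  Q = denominator ε′
  r = denominator (½ ℚ.- ε)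
  -- This is the factor of `moved-defect`; the further 7 in `K` comes from `size-weight`. Both
  -- depend on ε and ε′ only, through `Q` and `r`.
  K₀ = 7 ℕ.* (256 ℕ.* (10 ℕ.* Q ℕ.+ r ℕ.+ 1))
  K = 7 ℕ.* K₀
  instance
    P-nonZero : ℕ.NonZero P
    P-nonZero = ℕ.>-nonZero (1≤numerator ε′ 0<ε′)
  0<½-ε : 0ℚ ℚ.< ½ ℚ.- ε
  0<½-ε = subst (ℚ._< ½ ℚ.- ε) (+-inverseʳ ½) (+-monoʳ-< ½ (neg-antimono-< ε<½))
  1≤K : 1 ≤ K
  1≤K = ℕ.*-mono-≤ {1} {7} (ℕ.s≤s ℕ.z≤n) (ℕ.*-mono-≤ {1} {7} (ℕ.s≤s ℕ.z≤n)
    (ℕ.*-mono-≤ {1} {256} (ℕ.s≤s ℕ.z≤n) (ℕ.m≤n+m 1 (10 ℕ.* Q ℕ.+ r))))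
  constant = half-reciprocal K 1≤K
  2P≤Q = double-numerator ε′ 0<ε′ ε′<½

  main : (ℓ k : ℕ) → k ℕ.+ 4 ≤ ℓ → _
  main ℓ k k+4≤ℓ E B extractor dense (rows , columns , rows-differ , columns-differ) = robust , degrees
    where
    n = 2 ^ ℓ ∸ 1
    M = 2 ^ (ℓ ℕ.+ 2) ∸ 1
    G = graphG ℓ E B
    4≤ℓ : 4 ≤ ℓ
    4≤ℓ = ℕ.≤-trans (ℕ.m≤n+m 4 k) k+4≤ℓ
    near : ∀ {m x} → within ½ ((+ 1 / 10) * ε′) m x → NearHalf P Q m x
    near {m} {x} w = record { upper = within-upper ε′ 0<ε′ {m} {x} w ; lower = within-lower ε′ 0<ε′ {m} {x} w }
    dense′ : ∀ i → P ℕ.* (n ℕ.+ 1) ℕ.< Q ℕ.* countFin n (E i)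
    dense′ i = subst (λ L → P ℕ.* L ℕ.< Q ℕ.* countFin n (E i)) (sym (predecessor ℓ))
      (clear-< ε′ 0<ε′ (2 ^ ℓ) (countFin n (E i)) (dense i))
    module Γ = Graph ℓ E B {P} {Q} 2P≤Q dense′
      (λ i → near (rows i)) (λ k → near (columns k))
      (λ i i′ i≢i′ → near (rows-differ i i′ i≢i′)) (λ k k′ k≢k′ → near (columns-differ k k′ k≢k′))
      4≤ℓ

    robust : RobustlySelfOrdered G (proj₁ constant * ℕ→ℚ (FinGraph.size G))
    robust π = proj₂ (proj₂ constant) (FinGraph.size G) (moved G π) (orderedSymDiff G π)
      (size-weight {n} {t = moved G π} {K₀} {orderedSymDiff G π} (V-size ℓ) (3≤predecessor ℓ 4≤ℓ) (Γ.moved-defect π {r}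
        (λ S₁ S₀ f g f-free g-free large₁ large₀ → ≤-denominator (½ ℚ.- ε) 0<½-ε (countFin n S₁ ℕ.* countFin n S₀) _
          (flat-disagreement {k = k} {ε} {E} extractor f g f-free g-free S₁ S₀
            (source-size k+4≤ℓ large₁) (source-size k+4≤ℓ large₀)))))

    degrees-ℕ : ∀ v → 36 ℕ.* n ℕ.+ 27 ≤ 20 ℕ.* degree G v × 20 ℕ.* degree G v ≤ 102 ℕ.* n ℕ.+ 40
    degrees-ℕ (inj₁ j)        = Γ.deg₀-lower j , V₀₁-degree-upper {n} {degree G (inj₁ j)} (Γ.deg₀-upper j)
    degrees-ℕ (inj₂ (inj₁ i)) = Γ.deg₁-lower i , V₀₁-degree-upper {n} {degree G (inj₂ (inj₁ i))} (Γ.deg₁-upper i)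
    degrees-ℕ (inj₂ (inj₂ k)) = V₂-degree-lower {n} {degree G (inj₂ (inj₂ k))} (Γ.deg₂-lower k) , Γ.deg₂-upper k

    degrees : ∀ v → ((+ 3 / 10) * ℕ→ℚ (FinGraph.size G) ℚ.≤ ℕ→ℚ (degree G v)) ×
                    (ℕ→ℚ (degree G v) ℚ.≤ (+ 9 / 10) * ℕ→ℚ (FinGraph.size G))
    degrees v =
      -- The product of 1 / 10 and 3 evaluates to the literal 3 / 10 of the statement, and likewise
      -- for 9 / 10.
      tenth-≤ 3 (FinGraph.size G) (degree G v) (degree-lower {n} {d = degree G v} (V-size ℓ) (proj₁ (degrees-ℕ v))) ,
      ≤-tenth 9 (FinGraph.size G) (degree G v) (degree-upper {n} {d = degree G v} (V-size ℓ) (proj₂ (degrees-ℕ v)))
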